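{- If a $P_5$-hitting set with at most $k$ vertices of a connected graph $G$ can be computed in $\mathcal{O}^*(f(k))$ time, then INDEPENDENT CUTSET (with input $G$) can be solved in $\mathcal{O}^*(f(k)+3^k)$ time.
   Context: All graphs are finite, simple, loopless and undirected. A set $S$ of vertices of a graph $G$ is a cutset of $G$ if $G-S$ is disconnected; it is an independent set if its vertices are pairwise nonadjacent. An independent cutset of $G$ is a set of vertices that is both a cutset and an independent set of $G$. INDEPENDENT CUTSET is the decision problem: given a connected graph $G$, does $G$ have an independent cutset? $P_5$ denotes the path on five vertices. A graph is $P_5$-free if it does not contain $P_5$ as an induced subgraph. A $P_5$-hitting set of $G$ is a set of vertices $X$ such that $G-X$ is $P_5$-free. The notation $\mathcal{O}^*$ is the $\mathcal{O}$-notation with factors polynomial in the input size suppressed. -}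

module Defs where

open import Data.Bool.Base using (Bool; true; false; _∨_; T)
open import Data.Bool.Properties using (∨-comm; ∨-idem)
open import Data.Fin.Base using (Fin; toℕ)
open import Data.Fin.Subset using (Subset; _∈_; _∉_; ∣_∣)
open import Data.List.Base using (List; foldr; allFin; replicate)
open import Data.Nat.Base using (ℕ; zero; suc; _+_; _*_; _^_; _≤_; _≡ᵇ_)
open import Data.Product.Base using (Σ; ∃; ∃₂; _×_; proj₁)
open import Data.Vec.Base using (toList)
open import Function.Base using (id; _on_)
open import Function.Bundles using (_⇔_)
open import Function.Definitions using (Injective)
open import Relation.Binary.Construct.Closure.ReflexiveTransitive using (Star)
open import Relation.Binary.PropositionalEquality using (_≡_; refl; trans)
open import Relation.Nullary using (¬_)

record Graph (V : Set) : Set where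
  field
    adj    : V → V → Bool
    sym    : ∀ u v → adj u v ≡ adj v u
    irrefl : ∀ v → adj v v ≡ false

  Adj : V → V → Set
  Adj u v = T (adj u v)

open Graph public using (adj; Adj)

infixl 6 _-_

_-_ : ∀ {n} → Graph (Fin n) → (S : Subset n) → Graph (Σ (Fin n) (_∉ S))
G - S = record
  { adj    = adj G on proj₁
  ; sym    = λ u v → Graph.sym G (proj₁ u) (proj₁ v)
  ; irrefl = λ v → Graph.irrefl G (proj₁ v)
  }

Connected : ∀ {V} → Graph V → Set
Connected G = ∀ u v → Star (Adj G) u v

-- Stated with witnesses so that, in particular, the graph without
-- vertices is not disconnected: deleting all vertices is never a cut.
Disconnected : ∀ {V} → Graph V → Set
Disconnected G = ∃₂ λ u v → ¬ Star (Adj G) u v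

Cutset : ∀ {n} → Graph (Fin n) → Subset n → Set
Cutset G S = Disconnected (G - S)

Independent : ∀ {n} → Graph (Fin n) → Subset n → Set
Independent G S = ∀ u v → u ∈ S → v ∈ S → ¬ Adj G u v

IndependentCutset : ∀ {n} → Graph (Fin n) → Subset n → Set
IndependentCutset G S = Cutset G S × Independent G S

path : ∀ n → Graph (Fin n)
path n = record
  { adj    = λ i j → next (toℕ i) (toℕ j) ∨ next (toℕ j) (toℕ i)
  ; sym    = λ i j → ∨-comm (next (toℕ i) (toℕ j)) (next (toℕ j) (toℕ i))
  ; irrefl = λ i → trans (∨-idem (next (toℕ i) (toℕ i))) (next-irrefl (toℕ i))
  }
  where
  next : ℕ → ℕ → Bool
  next a b = suc a ≡ᵇ b

  next-irrefl : ∀ a → next a a ≡ false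
  next-irrefl zero    = refl
  next-irrefl (suc a) = next-irrefl a

_InducedSubgraphOf_ : ∀ {U V} → Graph U → Graph V → Set
_InducedSubgraphOf_ {U} {V} H G =
  ∃ λ (φ : U → V) → Injective _≡_ _≡_ φ × (∀ i j → adj G (φ i) (φ j) ≡ adj H i j)

P₅-Free : ∀ {V} → Graph V → Set
P₅-Free G = ¬ (path 5 InducedSubgraphOf G)

P₅-HittingSet : ∀ {n} → Graph (Fin n) → Subset n → Set
P₅-HittingSet G X = P₅-Free (G - X)

-- Model of computation: a variable-free form of Jones' WHILE language on
-- binary trees.  Every rule costs one step beyond the cost of its
-- premises; on trees represented by pointers each such step (copy a
-- pointer, allocate one node, project, test for nil) is a constant number
-- of random-access machine operations, and conversely a multitape Turing
-- machine is simulated with constant overhead per step.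

data Tree : Set where
  nil  : Tree
  node : Tree → Tree → Tree

size : Tree → ℕ
size nil        = 1
size (node a b) = suc (size a + size b)

head tail : Tree → Tree
head nil        = nil
head (node a b) = a
tail nil        = nil
tail (node a b) = b

infixr 5 _⨾_

data Program : Set where
  skip null hd tl : Program
  _⨾_             : Program → Program → Program
  ⟨_,_⟩           : Program → Program → Program
  if_then_else_   : Program → Program → Program → Program
  while_loop_     : Program → Program → Program

infix 4 _⊢_⇓_in-time_

-- p ⊢ x ⇓ y in-time t : on input x, the program p halts with output y after
-- exactly t steps.  As a truth value, nil is false and every node is true.
data _⊢_⇓_in-time_ : Program → Tree → Tree → ℕ → Set where

  skip : ∀ {x} → skip ⊢ x ⇓ x in-time 1
  null : ∀ {x} → null ⊢ x ⇓ nil in-time 1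
  hd   : ∀ {x} → hd ⊢ x ⇓ head x in-time 1
  tl   : ∀ {x} → tl ⊢ x ⇓ tail x in-time 1

  seq  : ∀ {p q x y z s t} →
         p ⊢ x ⇓ y in-time s →
         q ⊢ y ⇓ z in-time t →
         p ⨾ q ⊢ x ⇓ z in-time suc (s + t)

  pair : ∀ {p q x y z s t} →
         p ⊢ x ⇓ y in-time s →
         q ⊢ x ⇓ z in-time t →
         ⟨ p , q ⟩ ⊢ x ⇓ node y z in-time suc (s + t)

  then-branch : ∀ {p q r x a b y s t} →
         p ⊢ x ⇓ node a b in-time s →
         q ⊢ x ⇓ y in-time t →
         if p then q else r ⊢ x ⇓ y in-time suc (s + t)

  else-branch : ∀ {p q r x y s t} →
         p ⊢ x ⇓ nil in-time s →
         r ⊢ x ⇓ y in-time t →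
         if p then q else r ⊢ x ⇓ y in-time suc (s + t)

  stop : ∀ {p q x s} →
         p ⊢ x ⇓ nil in-time s →
         while p loop q ⊢ x ⇓ x in-time suc s

  step : ∀ {p q x a b y z s t u} →
         p ⊢ x ⇓ node a b in-time s →
         q ⊢ x ⇓ y in-time t →
         while p loop q ⊢ y ⇓ z in-time u →
         while p loop q ⊢ x ⇓ z in-time suc (s + t + u)

-- Encodings: a graph is given by its adjacency matrix, a vertex set by its
-- characteristic vector, the parameter k in unary.

encodeBool : Bool → Tree
encodeBool false = nil
encodeBool true  = node nil nil

encodeList : ∀ {A : Set} → (A → Tree) → List A → Tree
encodeList enc = foldr (λ a → node (enc a)) nil

encodeℕ : ℕ → Tree
encodeℕ k = encodeList id (replicate k nil)

encodeSubset : ∀ {n} → Subset n → Tree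
encodeSubset S = encodeList encodeBool (toList S)

encodeGraph : ∀ {n} → Graph (Fin n) → Tree
encodeGraph {n} G =
  encodeList (λ u → encodeList (λ v → encodeBool (adj G u v)) (allFin n)) (allFin n)

encodeInstance : ∀ {n} → Graph (Fin n) → ℕ → Tree
encodeInstance G k = node (encodeGraph G) (encodeℕ k)

-- The instances: connected graphs G together with a parameter k such that G
-- has a P₅-hitting set with at most k vertices.  Nothing is required of an
-- algorithm on other inputs.
Admissible : ∀ {n} → Graph (Fin n) → ℕ → Set
Admissible G k = Connected G × ∃ λ X → P₅-HittingSet G X × ∣ X ∣ ≤ k

-- OStar f c d G k is the bound f(k) · c · |G|ᵈ; a running time is O*(f(k)) when
-- it obeys this bound on all instances for some constants c and d.
OStar : (ℕ → ℕ) → ℕ → ℕ → ∀ {n} → Graph (Fin n) → ℕ → ℕ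
OStar f c d G k = f k * (c * size (encodeGraph G) ^ d)

P₅-HittingSet-ComputableInTimeOStar : (ℕ → ℕ) → Set
P₅-HittingSet-ComputableInTimeOStar f =
  ∃ λ (p : Program) → ∃₂ λ (c d : ℕ) →
  ∀ {n} (G : Graph (Fin n)) (k : ℕ) → Admissible G k →
  ∃₂ λ (X : Subset n) (t : ℕ) →
    p ⊢ encodeInstance G k ⇓ encodeSubset X in-time t ×
    P₅-HittingSet G X × ∣ X ∣ ≤ k ×
    t ≤ OStar f c d G k

IndependentCutset-SolvableInTimeOStar : (ℕ → ℕ) → Set
IndependentCutset-SolvableInTimeOStar f =
  ∃ λ (p : Program) → ∃₂ λ (c d : ℕ) →
  ∀ {n} (G : Graph (Fin n)) (k : ℕ) → Admissible G k →
  ∃₂ λ (answer : Bool) (t : ℕ) →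
    p ⊢ encodeInstance G k ⇓ encodeBool answer in-time t ×
    (T answer ⇔ ∃ λ S → IndependentCutset G S) ×
    t ≤ OStar f c d G k

{-# OPTIONS --safe #-}
-- Colour every vertex left, right or cut, so that left is never adjacent to
-- right, nor cut to cut; independent cutsets are the colourings using both left
-- and right.  Once the colours on the hitting set X (3^|X| ways) and one vertex
-- of either side are fixed, the components of G - X are independent of each
-- other.  In a connected P₅-free graph every inclusion-minimal connected
-- dominating set is a clique or has at most three vertices, so a colouring is
-- constant on it up to two exceptions.  Guessing these leaves at most two colours
-- per vertex, and extendability is then decided as for 2-SAT: arc consistency
-- must survive assigning some colour to any one vertex.  Running times are
-- polynomial because everything but the enumeration of the 3^|X| colourings is
-- compiled from a language whose loops all range over the vertices.
module Submission where

open import Data.Bool.Base using (Bool; true; false; T) renaming (if_then_else_ to ifᵇ_then_else_)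
open import Data.Bool.Properties using (T?) renaming (_≟_ to _≟ᵇ_)
open import Data.Empty using (⊥; ⊥-elim)
open import Data.Fin.Base using (Fin; zero; suc; toℕ; fromℕ<)
open import Data.Fin.Patterns using (0F; 1F; 2F; 3F; 4F)
open import Data.Fin.Properties using (toℕ-fromℕ<; toℕ<n; toℕ-injective; any?; all?; _≟_)
open import Data.Fin.Subset as Subset using (Subset; ∣_∣)
open import Data.List.Base
  using (List; []; _∷_; foldr; foldl; map; allFin; tabulate; drop; length; reverse)
open import Data.List.Properties using (length-tabulate; reverse-foldl; length-reverse)
open import Data.List.Membership.Propositional using (_∈_)
open import Data.List.Membership.Propositional.Properties using (∈-allFin)
open import Data.List.Relation.Binary.Permutation.Propositional.Properties using (↭-reverse; map⁺)
open import Data.List.Relation.Unary.All as All using (All; []; _∷_)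
open import Data.List.Relation.Unary.Any using (here; there)
open import Data.Maybe.Base using (Maybe; just; nothing; _<∣>_)
open import Data.Nat.Base
  using (ℕ; zero; suc; _+_; _*_; _^_; _∸_; _≤_; _<_; _≡ᵇ_; z≤n; s≤s)
open import Data.Nat.ListAction using (product)
open import Data.Nat.ListAction.Properties using (product-↭)
open import Data.Nat.Properties hiding (_≟_)
open import Data.Product.Base using (Σ; ∃; ∃₂; _×_; _,_; proj₁; proj₂)
open import Data.Sum.Base using (_⊎_; inj₁; inj₂; [_,_]′)
open import Data.Unit.Base using (⊤; tt)
open import Data.Vec.Base as Vec using (Vec; []; _∷_; lookup; toList)
open import Data.Vec.Properties using (lookup⇒[]=; []=⇒lookup; lookup∘tabulate; length-toList)
open import Function.Base using (id; _∘_; flip)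
open import Function.Bundles using (_⇔_; mk⇔; Equivalence)
open import Relation.Binary.Construct.Closure.ReflexiveTransitive using (Star; ε; _◅_; _◅◅_)
open import Relation.Binary.PropositionalEquality
  using (_≡_; _≢_; refl; cong; sym; trans; subst; subst₂; module ≡-Reasoning)
open import Relation.Nullary using (¬_; Dec; yes; no; contradiction)
open import Relation.Nullary.Decidable
  using (decidable-stable; from-yes; ¬?; _×-dec_; _⊎-dec_; _→-dec_)
open import Defs

open Equivalence using (to; from)

-- No edge joins two cut vertices, or left to right, so a clique has at most one cut vertex and its
-- other vertices share a side; in the three-vertex case two vertices are exceptions and the third
-- sets the constant. Every colour is incompatible with some colour, so a neighbour of a coloured
-- vertex loses a colour, and domination makes all lists binary. Propagating an assignment through
-- binary lists without emptying one fixes some vertices and leaves every other list untouched; such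
-- partial colourings can be laid over one another, so one surviving propagation per vertex suffices
-- and nothing is backtracked. The same overlaying glues the components of `G - X`, so their guesses
-- are tried separately and do not multiply. The structure theorem rests on private neighbours: a
-- vertex whose removal keeps the minimal set connected must alone dominate some vertex, and two
-- nonadjacent vertices of this kind leave room for only one more before an induced `P₅` appears.
-- Connectivity arguments use arbitrary predicates while the program computes Booleans, so they are
-- proved up to double negation, which Boolean conclusions absorb.

-- Running times up to an upper bound

infix 4 _⊢_⇓_within_

_⊢_⇓_within_ : Program → Tree → Tree → ℕ → Set
p ⊢ x ⇓ y within b = ∃ λ t → p ⊢ x ⇓ y in-time t × t ≤ b

weaken-within : ∀ {p x y b b′} → b ≤ b′ → p ⊢ x ⇓ y within b → p ⊢ x ⇓ y within b′
weaken-within b≤b′ (t , r , t≤b) = t , r , ≤-trans t≤b b≤b′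

skipʷ : ∀ {x} → skip ⊢ x ⇓ x within 1
skipʷ = 1 , skip , ≤-refl

nullʷ : ∀ {x} → null ⊢ x ⇓ nil within 1
nullʷ = 1 , null , ≤-refl

hdʷ : ∀ {x} → hd ⊢ x ⇓ head x within 1
hdʷ = 1 , hd , ≤-refl

tlʷ : ∀ {x} → tl ⊢ x ⇓ tail x within 1
tlʷ = 1 , tl , ≤-refl

infixr 5 _⨾ʷ_

_⨾ʷ_ : ∀ {p q x y z a b} → p ⊢ x ⇓ y within a → q ⊢ y ⇓ z within b →
       p ⨾ q ⊢ x ⇓ z within suc (a + b)
(_ , r , s≤a) ⨾ʷ (_ , r′ , t≤b) = _ , seq r r′ , s≤s (+-mono-≤ s≤a t≤b)

⟨_,_⟩ʷ : ∀ {p q x y z a b} → p ⊢ x ⇓ y within a → q ⊢ x ⇓ z within b →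
         ⟨ p , q ⟩ ⊢ x ⇓ node y z within suc (a + b)
⟨ (_ , r , s≤a) , (_ , r′ , t≤b) ⟩ʷ = _ , pair r r′ , s≤s (+-mono-≤ s≤a t≤b)

thenʷ : ∀ {p q r x y y₁ y₂ a b} → p ⊢ x ⇓ node y₁ y₂ within a → q ⊢ x ⇓ y within b →
        if p then q else r ⊢ x ⇓ y within suc (a + b)
thenʷ (_ , r , s≤a) (_ , r′ , t≤b) = _ , then-branch r r′ , s≤s (+-mono-≤ s≤a t≤b)

elseʷ : ∀ {p q r x y a b} → p ⊢ x ⇓ nil within a → r ⊢ x ⇓ y within b →
        if p then q else r ⊢ x ⇓ y within suc (a + b)
elseʷ (_ , r , s≤a) (_ , r′ , t≤b) = _ , else-branch r r′ , s≤s (+-mono-≤ s≤a t≤b)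

-- Both branches are charged, so the bound does not depend on the truth value. This is what lets
-- `cost` below ignore the data.
ifʷ : ∀ {p q r x a b c} {A : Set} (enc : A → Tree) (β : Bool) (y z : A) →
      p ⊢ x ⇓ encodeBool β within a → q ⊢ x ⇓ enc y within b → r ⊢ x ⇓ enc z within c →
      if p then q else r ⊢ x ⇓ enc (ifᵇ β then y else z) within suc (a + (b + c))
ifʷ {a = a} {b} {c} _ true  _ _ P Q R = weaken-within (s≤s (+-monoʳ-≤ a (m≤m+n b c))) (thenʷ P Q)
ifʷ {a = a} {b} {c} _ false _ _ P Q R = weaken-within (s≤s (+-monoʳ-≤ a (m≤n+m c b))) (elseʷ P R)

falseᵖ trueᵖ : Program
falseᵖ = null
trueᵖ  = ⟨ null , null ⟩

trueʷ : ∀ {x} → trueᵖ ⊢ x ⇓ encodeBool true within 3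
trueʷ = ⟨ nullʷ , nullʷ ⟩ʷ

-- Loops consuming a list

consume : Program → Program
consume q = while hd loop ⟨ hd ⨾ tl , q ⟩

-- Of the six extra steps per round, one is the `while` rule, one its test, one the pair and three
-- `hd ⨾ tl`. The final 2 pay for the failing test and for stopping.
loopCost : ℕ → ℕ → ℕ
loopCost m b = m * (b + 6) + 2

consume-step : ∀ {q x t s s′ u b} m →
  q ⊢ node (node x t) s ⇓ s′ within b →
  consume q ⊢ node t s′ ⇓ u within loopCost m b →
  consume q ⊢ node (node x t) s ⇓ u within loopCost (suc m) b
consume-step {b = b} m Q (_ , r′ , t′≤) with ⟨ hdʷ ⨾ʷ tlʷ , Q ⟩ʷ
... | t , r , t≤ = _ , step hd r r′ , (begin
  suc (1 + t + _)                      ≤⟨ s≤s (+-mono-≤ (s≤s t≤) t′≤) ⟩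
  suc (1 + suc (3 + b) + loopCost m b) ≡⟨ cong (_+ loopCost m b) (+-comm 6 b) ⟩
  b + 6 + (m * (b + 6) + 2)            ≡⟨ +-assoc (b + 6) (m * (b + 6)) 2 ⟨
  loopCost (suc m) b                   ∎)
  where open ≤-Reasoning

consume-nil : ∀ {q s} → consume q ⊢ node nil s ⇓ node nil s within 2
consume-nil = 2 , stop hd , ≤-refl

countdown : ∀ {q b} (s : ℕ → Tree) m →
  (∀ i → i < m → q ⊢ node (encodeℕ (suc i)) (s (suc i)) ⇓ s i within b) →
  consume q ⊢ node (encodeℕ m) (s m) ⇓ node nil (s 0) within loopCost m b
countdown s zero    Q = consume-nil
countdown s (suc m) Q =
  consume-step m (Q m ≤-refl) (countdown s m (λ i i<m → Q i (m≤n⇒m≤1+n i<m)))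

-- The invariant ties the remaining list to the state. It yields a uniform bound `b` even when the
-- run of the body is only controlled for states that can actually arise.
consume-foldl : ∀ {A B : Set} (encᴬ : A → Tree) (encᴮ : B → Tree) (g : B → A → B)
  (Inv : List A → B → Set) {q b} →
  (∀ x xs s → Inv (x ∷ xs) s →
    Inv xs (g s x) × q ⊢ node (encodeList encᴬ (x ∷ xs)) (encᴮ s) ⇓ encᴮ (g s x) within b) →
  ∀ xs s → Inv xs s →
  consume q ⊢ node (encodeList encᴬ xs) (encᴮ s) ⇓ node nil (encᴮ (foldl g s xs))
    within loopCost (length xs) b
consume-foldl encᴬ encᴮ g Inv Q []       s inv = consume-nil
consume-foldl encᴬ encᴮ g Inv Q (x ∷ xs) s inv with Q x xs s inv
... | inv′ , R = consume-step (length xs) R (consume-foldl encᴬ encᴮ g Inv Q xs (g s x) inv′)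

tails : ℕ → Tree → Tree
tails zero    x = x
tails (suc m) x = tails m (tail x)

consume-tails : ∀ m x →
  consume (tl ⨾ tl) ⊢ node (encodeℕ m) x ⇓ node nil (tails m x) within loopCost m 3
consume-tails zero    x = consume-nil
consume-tails (suc m) x = consume-step m (tlʷ ⨾ʷ tlʷ) (consume-tails m (tail x))

tails-encodeList : ∀ {A : Set} (enc : A → Tree) m xs →
  tails m (encodeList enc xs) ≡ encodeList enc (drop m xs)
tails-encodeList enc zero    xs       = refl
tails-encodeList enc (suc m) []       = tails-encodeList-[] m
  where
  tails-encodeList-[] : ∀ m → tails m nil ≡ nil
  tails-encodeList-[] zero    = refl
  tails-encodeList-[] (suc m) = tails-encodeList-[] m
tails-encodeList enc (suc m) (x ∷ xs) = tails-encodeList enc m xs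

tails-encodeℕ : ∀ m k → tails m (encodeℕ k) ≡ encodeℕ (k ∸ m)
tails-encodeℕ zero    k       = refl
tails-encodeℕ (suc m) (suc k) = tails-encodeℕ m k
tails-encodeℕ (suc m) zero    = trans (tails-encodeℕ m 0) (cong encodeℕ (0∸n≡0 m))

drop-tabulate : ∀ {A : Set} {n} (f : Fin n → A) i →
  drop (toℕ i) (tabulate f) ≡ f i ∷ drop (suc (toℕ i)) (tabulate f)
drop-tabulate f zero    = refl
drop-tabulate f (suc i) = drop-tabulate (f ∘ suc) i

drop-all-tabulate : ∀ {A : Set} {n} (f : Fin n → A) → drop n (tabulate f) ≡ []
drop-all-tabulate {n = zero}  f = refl
drop-all-tabulate {n = suc n} f = drop-all-tabulate (f ∘ suc)

-- A language of polynomial-time computations on graphs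

data Color : Set where
  left right cut : Color

data Ty : Set where
  bool ix  : Ty
  row cols : Ty → Ty

Ctx : Set
Ctx = List Ty

infixl 9 _!_ _at_

-- `call` evaluates its arguments once and runs its body in the environment made of them alone. It
-- thus serves as `let` and as a call of a closed subroutine, and no weakening of expressions is
-- ever needed.
data Exp (Γ : Ctx) : Ty → Set where
  var  : ∀ {τ} → τ ∈ Γ → Exp Γ τ
  lit  : Bool → Exp Γ bool
  cond : ∀ {τ} → Exp Γ bool → Exp Γ τ → Exp Γ τ → Exp Γ τ
  mk   : ∀ {τ} → (Color → Exp Γ τ) → Exp Γ (cols τ)
  _at_ : ∀ {τ} → Exp Γ (cols τ) → Color → Exp Γ τ
  tab  : ∀ {τ} → Exp (ix ∷ Γ) τ → Exp Γ (row τ)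
  _!_  : ∀ {τ} → Exp Γ (row τ) → Exp Γ ix → Exp Γ τ
  le   : Exp Γ ix → Exp Γ ix → Exp Γ bool
  fold : ∀ {τ} → Exp (ix ∷ τ ∷ Γ) τ → Exp Γ τ → Exp Γ τ
  call : ∀ {Δ τ} → Exp Δ τ → All (Exp Γ) Δ → Exp Γ τ

⟦_⟧ : Ty → ℕ → Set
⟦ bool ⟧   n = Bool
⟦ ix ⟧     n = Fin n
⟦ row τ ⟧  n = Fin n → ⟦ τ ⟧ n
⟦ cols τ ⟧ n = Color → ⟦ τ ⟧ n

Env : ℕ → Ctx → Set
Env n = All (λ τ → ⟦ τ ⟧ n)

foldFin : ∀ {B : Set} {n} → (Fin n → B → B) → B → B
foldFin {n = n} f s = foldr f s (allFin n)

eval     : ∀ {Γ τ} → Exp Γ τ → ∀ {n} → Env n Γ → ⟦ τ ⟧ n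
evalArgs : ∀ {Γ Δ} → All (Exp Γ) Δ → ∀ {n} → Env n Γ → Env n Δ

eval (var x)      ρ = All.lookup ρ x
eval (lit b)      ρ = b
eval (cond b d e) ρ = ifᵇ eval b ρ then eval d ρ else eval e ρ
eval (mk f)       ρ = λ c → eval (f c) ρ
eval (e at c)     ρ = eval e ρ c
eval (tab e)      ρ = λ i → eval e (i ∷ ρ)
eval (e ! i)      ρ = eval e ρ (eval i ρ)
eval (le i j)     ρ = (toℕ (eval i ρ) ∸ toℕ (eval j ρ)) ≡ᵇ 0
eval (fold e s)   ρ = foldFin (λ i x → eval e (i ∷ x ∷ ρ)) (eval s ρ)
eval (call e es)  ρ = eval e (evalArgs es ρ)

evalArgs []       ρ = []
evalArgs (e ∷ es) ρ = eval e ρ ∷ evalArgs es ρ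

encode : ∀ τ {n} → ⟦ τ ⟧ n → Tree
encode bool     b     = encodeBool b
encode ix       i     = encodeℕ (toℕ i)
encode (row τ)  {n} f = encodeList (λ i → encode τ (f i)) (allFin n)
encode (cols τ) f     = node (encode τ (f left)) (node (encode τ (f right)) (encode τ (f cut)))

-- The number of vertices, which drives all loops, sits at the bottom of the environment.
encodeEnv : ∀ {Γ n} → Env n Γ → Tree
encodeEnv {n = n} []  = encodeℕ n
encodeEnv     (v ∷ ρ) = node (encode _ v) (encodeEnv ρ)

-- Compilation into programs and its cost

varᵖ : ∀ {τ : Ty} {Γ} → τ ∈ Γ → Program
varᵖ (here _)  = hd
varᵖ (there x) = tl ⨾ varᵖ x

orderᵖ : Ctx → Program
orderᵖ []      = skip
orderᵖ (_ ∷ Γ) = tl ⨾ orderᵖ Γ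

tabᵖ : Program → Program
tabᵖ p = ⟨ ⟨ ⟨ hd ⨾ tl , tl ⨾ tl ⟩ ⨾ p , tl ⨾ hd ⟩ , tl ⨾ tl ⟩

foldᵖ : Program → Program
foldᵖ p = ⟨ ⟨ hd ⨾ tl , tl ⟩ ⨾ p , tl ⨾ tl ⟩

compile     : ∀ {Γ τ} → Exp Γ τ → Program
compileArgs : ∀ {Γ Δ} → All (Exp Γ) Δ → Program

compile (var x)        = varᵖ x
compile (lit true)     = trueᵖ
compile (lit false)    = falseᵖ
compile (cond b d e)   = if compile b then compile d else compile e
compile (mk f)         = ⟨ compile (f left) , ⟨ compile (f right) , compile (f cut) ⟩ ⟩
compile (e at left)    = compile e ⨾ hd
compile (e at right)   = compile e ⨾ tl ⨾ hd
compile (e at cut)     = compile e ⨾ tl ⨾ tl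
compile {Γ} (tab e)    = ⟨ orderᵖ Γ , ⟨ null , skip ⟩ ⟩ ⨾ consume (tabᵖ (compile e)) ⨾ tl ⨾ hd
compile (e ! i)        = ⟨ compile i , compile e ⟩ ⨾ consume (tl ⨾ tl) ⨾ tl ⨾ hd
compile (le i j)       = ⟨ compile j , compile i ⟩ ⨾ consume (tl ⨾ tl) ⨾ if tl then falseᵖ else trueᵖ
compile {Γ} (fold e s) = ⟨ orderᵖ Γ , ⟨ compile s , skip ⟩ ⟩ ⨾ consume (foldᵖ (compile e)) ⨾ tl ⨾ hd
compile (call e es)    = compileArgs es ⨾ compile e

compileArgs {Γ} []     = orderᵖ Γ
compileArgs (e ∷ es)   = ⟨ compile e , compileArgs es ⟩

varCost : ∀ {τ : Ty} {Γ} → τ ∈ Γ → ℕ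
varCost (here _)  = 1
varCost (there x) = 2 + varCost x

orderCost : Ctx → ℕ
orderCost []      = 1
orderCost (_ ∷ Γ) = 2 + orderCost Γ

-- A function of the number of vertices only: copying a tree is one step whatever its size, and
-- every loop makes at most `n` rounds.
cost     : ∀ {Γ τ} → Exp Γ τ → ℕ → ℕ
costArgs : ∀ {Γ Δ} → All (Exp Γ) Δ → ℕ → ℕ

cost (var x)        n = varCost x
cost (lit _)        n = 3
cost (cond b d e)   n = suc (cost b n + (cost d n + cost e n))
cost (mk f)         n = suc (cost (f left) n + suc (cost (f right) n + cost (f cut) n))
cost (e at _)       n = suc (cost e n + 3)
cost {Γ} (tab e)    n = suc (suc (orderCost Γ + 3) + suc (loopCost n (suc (suc (suc (7 + cost e n) + 3) + 3)) + 3))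
cost (e ! i)        n = suc (suc (cost i n + cost e n) + suc (loopCost n 3 + 3))
cost (le i j)       n = suc (suc (cost j n + cost i n) + suc (loopCost n 3 + 5))
cost {Γ} (fold e s) n = suc (suc (orderCost Γ + suc (cost s n + 1)) + suc (loopCost n (suc (suc (5 + cost e n) + 3)) + 3))
cost (call e es)    n = suc (costArgs es n + cost e n)

costArgs {Γ} []     n = orderCost Γ
costArgs (e ∷ es)   n = suc (cost e n + costArgs es n)

var-correct : ∀ {τ Γ n} (x : τ ∈ Γ) (ρ : Env n Γ) →
  varᵖ x ⊢ encodeEnv ρ ⇓ encode τ (All.lookup ρ x) within varCost x
var-correct (here refl) (v ∷ ρ) = hdʷ
var-correct (there x)   (v ∷ ρ) = tlʷ ⨾ʷ var-correct x ρ

order-correct : ∀ {Γ n} (ρ : Env n Γ) → orderᵖ Γ ⊢ encodeEnv ρ ⇓ encodeℕ n within orderCost Γ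
order-correct []      = skipʷ
order-correct (v ∷ ρ) = tlʷ ⨾ʷ order-correct ρ

loopCost-monoˡ : ∀ {m n} b → m ≤ n → loopCost m b ≤ loopCost n b
loopCost-monoˡ b m≤n = +-monoˡ-≤ 2 (*-monoˡ-≤ (b + 6) m≤n)

drop-allFin : ∀ {n} i (i<n : i < n) → drop i (allFin n) ≡ fromℕ< i<n ∷ drop (suc i) (allFin n)
drop-allFin {n} i i<n = subst (λ k → drop k (allFin n) ≡ fromℕ< i<n ∷ drop (suc k) (allFin n))
  (toℕ-fromℕ< i<n) (drop-tabulate id (fromℕ< i<n))

-- The counter runs down, so the row is built from its end: with the counter at `m` it holds the
-- entries from index `m` on. The body sees the counter before it drops, which is why its index is
-- the tail of the counter.
tab-correct : ∀ {A : Set} {n p b t} (f : Fin n → A) (enc : A → Tree) →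
  (∀ i → p ⊢ node (encodeℕ (toℕ i)) t ⇓ enc (f i) within b) →
  consume (tabᵖ p) ⊢ node (encodeℕ n) (node nil t)
    ⇓ node nil (node (encodeList (λ i → enc (f i)) (allFin n)) t)
    within loopCost n (suc (suc (suc (7 + b) + 3) + 3))
tab-correct {n = n} {p} {b} {t} f enc P =
  subst (λ xs → consume (tabᵖ p) ⊢ node (encodeℕ n) (node (encodeList (λ i → enc (f i)) xs) t)
                  ⇓ node nil (s 0) within loopCost n k)
    (drop-all-tabulate id) (countdown s n body)
  where
  k : ℕ
  k = suc (suc (suc (7 + b) + 3) + 3)

  s : ℕ → Tree
  s m = node (encodeList (λ i → enc (f i)) (drop m (allFin n))) t

  body : ∀ i → i < n → tabᵖ p ⊢ node (encodeℕ (suc i)) (s (suc i)) ⇓ s i within k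
  body i i<n rewrite drop-allFin i i<n =
    ⟨ ⟨ ⟨ hdʷ ⨾ʷ tlʷ , tlʷ ⨾ʷ tlʷ ⟩ʷ ⨾ʷ
        subst (λ j → p ⊢ node (encodeℕ j) t ⇓ enc (f (fromℕ< i<n)) within b) (toℕ-fromℕ< i<n) (P (fromℕ< i<n))
      , tlʷ ⨾ʷ hdʷ ⟩ʷ
    , tlʷ ⨾ʷ tlʷ ⟩ʷ

fold-correct : ∀ {A : Set} {n p b t} (f : Fin n → A → A) (enc : A → Tree) →
  (∀ i x → p ⊢ node (encodeℕ (toℕ i)) (node (enc x) t) ⇓ enc (f i x) within b) →
  ∀ x →
  consume (foldᵖ p) ⊢ node (encodeℕ n) (node (enc x) t) ⇓ node nil (node (enc (foldFin f x)) t)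
    within loopCost n (suc (suc (5 + b) + 3))
fold-correct {n = n} {p} {b} {t} f enc P x =
  subst (λ xs → consume (foldᵖ p) ⊢ node (encodeℕ n) (node (enc (foldr f x xs)) t)
                  ⇓ node nil (s 0) within loopCost n k)
    (drop-all-tabulate id) (countdown s n body)
  where
  k : ℕ
  k = suc (suc (5 + b) + 3)

  rest : ℕ → _
  rest i = foldr f x (drop (suc i) (allFin n))

  s : ℕ → Tree
  s m = node (enc (foldr f x (drop m (allFin n)))) t

  body : ∀ i → i < n → foldᵖ p ⊢ node (encodeℕ (suc i)) (s (suc i)) ⇓ s i within k
  body i i<n rewrite drop-allFin i i<n =
    ⟨ ⟨ hdʷ ⨾ʷ tlʷ , tlʷ ⟩ʷ ⨾ʷ
      subst (λ j → p ⊢ node (encodeℕ j) (s (suc i)) ⇓ enc (f (fromℕ< i<n) (rest i)) within b)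
        (toℕ-fromℕ< i<n) (P (fromℕ< i<n) (rest i))
    , tlʷ ⨾ʷ tlʷ ⟩ʷ

tails-row : ∀ {A : Set} {n} (f : Fin n → A) (enc : A → Tree) i →
  head (tails (toℕ i) (encodeList (λ i → enc (f i)) (allFin n))) ≡ enc (f i)
tails-row {n = n} f enc i
  rewrite tails-encodeList (λ i → enc (f i)) (toℕ i) (allFin n) | drop-tabulate id i = refl

compile-correct : ∀ {Γ τ} (e : Exp Γ τ) {n} (ρ : Env n Γ) →
  compile e ⊢ encodeEnv ρ ⇓ encode τ (eval e ρ) within cost e n
compileArgs-correct : ∀ {Γ Δ} (es : All (Exp Γ) Δ) {n} (ρ : Env n Γ) →
  compileArgs es ⊢ encodeEnv ρ ⇓ encodeEnv (evalArgs es ρ) within costArgs es n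

compile-correct (var x) ρ = var-correct x ρ
compile-correct (lit true)  ρ = trueʷ
compile-correct (lit false) ρ = weaken-within (s≤s z≤n) nullʷ
compile-correct {τ = τ} (cond b d e) ρ =
  ifʷ (encode τ) (eval b ρ) (eval d ρ) (eval e ρ)
    (compile-correct b ρ) (compile-correct d ρ) (compile-correct e ρ)
compile-correct (mk f) ρ =
  ⟨ compile-correct (f left) ρ , ⟨ compile-correct (f right) ρ , compile-correct (f cut) ρ ⟩ʷ ⟩ʷ
compile-correct (e at left) {n} ρ =
  weaken-within (s≤s (+-monoʳ-≤ (cost e n) (s≤s z≤n))) (compile-correct e ρ ⨾ʷ hdʷ)
compile-correct (e at right) ρ = compile-correct e ρ ⨾ʷ tlʷ ⨾ʷ hdʷ
compile-correct (e at cut)   ρ = compile-correct e ρ ⨾ʷ tlʷ ⨾ʷ tlʷ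
compile-correct {τ = row τ} (tab e) ρ =
  ⟨ order-correct ρ , ⟨ nullʷ , skipʷ ⟩ʷ ⟩ʷ ⨾ʷ
  tab-correct (λ i → eval e (i ∷ ρ)) (encode τ) (λ i → compile-correct e (i ∷ ρ)) ⨾ʷ
  tlʷ ⨾ʷ hdʷ
compile-correct {τ = τ} (e ! i) {n} ρ =
  ⟨ compile-correct i ρ , compile-correct e ρ ⟩ʷ ⨾ʷ
  weaken-within (loopCost-monoˡ 3 (<⇒≤ (toℕ<n (eval i ρ)))) (consume-tails (toℕ (eval i ρ)) _) ⨾ʷ
  tlʷ ⨾ʷ
  subst (λ t → hd ⊢ tails (toℕ (eval i ρ)) (encode (row τ) (eval e ρ)) ⇓ t within 1)
    (tails-row (eval e ρ) (encode τ) (eval i ρ)) hdʷ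
compile-correct (le i j) {n} ρ =
  ⟨ compile-correct j ρ , compile-correct i ρ ⟩ʷ ⨾ʷ
  weaken-within (loopCost-monoˡ 3 (<⇒≤ (toℕ<n (eval j ρ)))) (consume-tails (toℕ (eval j ρ)) _) ⨾ʷ
  subst (λ t → if tl then falseᵖ else trueᵖ ⊢ node nil t
                 ⇓ encodeBool ((toℕ (eval i ρ) ∸ toℕ (eval j ρ)) ≡ᵇ 0) within 5)
    (sym (tails-encodeℕ (toℕ (eval j ρ)) (toℕ (eval i ρ)))) (zero? (toℕ (eval i ρ) ∸ toℕ (eval j ρ)))
  where
  zero? : ∀ k → if tl then falseᵖ else trueᵖ ⊢ node nil (encodeℕ k) ⇓ encodeBool (k ≡ᵇ 0) within 5
  zero? zero    = elseʷ tlʷ trueʷ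
  zero? (suc k) = weaken-within (s≤s (s≤s (s≤s z≤n))) (thenʷ tlʷ nullʷ)
compile-correct {τ = τ} (fold e s) ρ =
  ⟨ order-correct ρ , ⟨ compile-correct s ρ , skipʷ ⟩ʷ ⟩ʷ ⨾ʷ
  fold-correct (λ i x → eval e (i ∷ x ∷ ρ)) (encode τ)
    (λ i x → compile-correct e (i ∷ x ∷ ρ)) (eval s ρ) ⨾ʷ
  tlʷ ⨾ʷ hdʷ
compile-correct (call e es) ρ = compileArgs-correct es ρ ⨾ʷ compile-correct e (evalArgs es ρ)

compileArgs-correct []       ρ = order-correct ρ
compileArgs-correct (e ∷ es) ρ = ⟨ compile-correct e ρ , compileArgs-correct es ρ ⟩ʷ

-- Polynomial bounds

Polynomial : (ℕ → ℕ) → Set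
Polynomial h = ∃₂ λ c d → ∀ n → h n ≤ c * suc n ^ d

polynomial-const : ∀ k → Polynomial (λ _ → k)
polynomial-const k = k , 0 , λ n → ≤-reflexive (sym (*-identityʳ k))

polynomial-id : Polynomial id
polynomial-id = 1 , 1 , λ n → begin
  n               ≤⟨ n≤1+n n ⟩
  suc n           ≡⟨ *-identityʳ (suc n) ⟨
  suc n * 1       ≡⟨ *-identityˡ (suc n * 1) ⟨
  1 * (suc n * 1) ∎
  where open ≤-Reasoning

-- The base `suc m` is positive, so either exponent may be raised to the sum of both.
monomial-+ : ∀ m c c′ d d′ → c * suc m ^ d + c′ * suc m ^ d′ ≤ (c + c′) * suc m ^ (d + d′)
monomial-+ m c c′ d d′ = begin
  c * suc m ^ d + c′ * suc m ^ d′
    ≤⟨ +-mono-≤ (*-monoʳ-≤ c (^-monoʳ-≤ (suc m) (m≤m+n d d′)))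
                (*-monoʳ-≤ c′ (^-monoʳ-≤ (suc m) (m≤n+m d′ d))) ⟩
  c * suc m ^ (d + d′) + c′ * suc m ^ (d + d′)
    ≡⟨ *-distribʳ-+ (suc m ^ (d + d′)) c c′ ⟨
  (c + c′) * suc m ^ (d + d′) ∎
  where open ≤-Reasoning

polynomial-+ : ∀ {g h} → Polynomial g → Polynomial h → Polynomial (λ n → g n + h n)
polynomial-+ (c , d , g≤) (c′ , d′ , h≤) =
  c + c′ , d + d′ , λ n → ≤-trans (+-mono-≤ (g≤ n) (h≤ n)) (monomial-+ n c c′ d d′)

polynomial-* : ∀ {g h} → Polynomial g → Polynomial h → Polynomial (λ n → g n * h n)
polynomial-* {g} {h} (c , d , g≤) (c′ , d′ , h≤) = c * c′ , d + d′ , λ n → begin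
  g n * h n                             ≤⟨ *-mono-≤ (g≤ n) (h≤ n) ⟩
  (c * suc n ^ d) * (c′ * suc n ^ d′)   ≡⟨ [m*n]*[o*p]≡[m*o]*[n*p] c (suc n ^ d) c′ (suc n ^ d′) ⟩
  (c * c′) * (suc n ^ d * suc n ^ d′)   ≡⟨ cong ((c * c′) *_) (^-distribˡ-+-* (suc n) d d′) ⟨
  (c * c′) * suc n ^ (d + d′)           ∎
  where open ≤-Reasoning

polynomial-suc : ∀ {g} → Polynomial g → Polynomial (λ n → suc (g n))
polynomial-suc = polynomial-+ (polynomial-const 1)

polynomial-loopCost : ∀ {g h} → Polynomial g → Polynomial h → Polynomial (λ n → loopCost (g n) (h n))
polynomial-loopCost G H =
  polynomial-+ (polynomial-* G (polynomial-+ H (polynomial-const 6))) (polynomial-const 2)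

cost-polynomial     : ∀ {Γ τ} (e : Exp Γ τ) → Polynomial (cost e)
costArgs-polynomial : ∀ {Γ Δ} (es : All (Exp Γ) Δ) → Polynomial (costArgs es)

cost-polynomial (var x)      = polynomial-const (varCost x)
cost-polynomial (lit _)      = polynomial-const 3
cost-polynomial (cond b d e) =
  polynomial-suc (polynomial-+ (cost-polynomial b)
    (polynomial-+ (cost-polynomial d) (cost-polynomial e)))
cost-polynomial (mk f)       =
  polynomial-suc (polynomial-+ (cost-polynomial (f left))
    (polynomial-suc (polynomial-+ (cost-polynomial (f right)) (cost-polynomial (f cut)))))
cost-polynomial (e at _)     = polynomial-suc (polynomial-+ (cost-polynomial e) (polynomial-const 3))
cost-polynomial {Γ} (tab e)  =
  polynomial-suc (polynomial-+ (polynomial-const (suc (orderCost Γ + 3)))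
    (polynomial-suc (polynomial-+
      (polynomial-loopCost polynomial-id
        (polynomial-suc (polynomial-+
          (polynomial-suc (polynomial-+
            (polynomial-suc (polynomial-+ (polynomial-const 7) (cost-polynomial e)))
            (polynomial-const 3)))
          (polynomial-const 3))))
      (polynomial-const 3))))
cost-polynomial (e ! i)      =
  polynomial-suc (polynomial-+ (polynomial-suc (polynomial-+ (cost-polynomial i) (cost-polynomial e)))
    (polynomial-suc (polynomial-+
      (polynomial-loopCost polynomial-id (polynomial-const 3)) (polynomial-const 3))))
cost-polynomial (le i j)     =
  polynomial-suc (polynomial-+ (polynomial-suc (polynomial-+ (cost-polynomial j) (cost-polynomial i)))
    (polynomial-suc (polynomial-+
      (polynomial-loopCost polynomial-id (polynomial-const 3)) (polynomial-const 5))))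
cost-polynomial {Γ} (fold e s) =
  polynomial-suc (polynomial-+
    (polynomial-suc (polynomial-+ (polynomial-const (orderCost Γ))
      (polynomial-suc (polynomial-+ (cost-polynomial s) (polynomial-const 1)))))
    (polynomial-suc (polynomial-+
      (polynomial-loopCost polynomial-id
        (polynomial-suc (polynomial-+
          (polynomial-suc (polynomial-+ (polynomial-const 5) (cost-polynomial e)))
          (polynomial-const 3))))
      (polynomial-const 3))))
cost-polynomial (call e es)  = polynomial-suc (polynomial-+ (costArgs-polynomial es) (cost-polynomial e))

costArgs-polynomial {Γ} []   = polynomial-const (orderCost Γ)
costArgs-polynomial (e ∷ es) = polynomial-suc (polynomial-+ (cost-polynomial e) (costArgs-polynomial es))

-- Derived expressions

v0 : ∀ {Γ a} → Exp (a ∷ Γ) a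
v0 = var (here refl)

v1 : ∀ {Γ a b} → Exp (a ∷ b ∷ Γ) b
v1 = var (there (here refl))

v2 : ∀ {Γ a b c} → Exp (a ∷ b ∷ c ∷ Γ) c
v2 = var (there (there (here refl)))

v3 : ∀ {Γ a b c d} → Exp (a ∷ b ∷ c ∷ d ∷ Γ) d
v3 = var (there (there (there (here refl))))

v4 : ∀ {Γ a b c d e} → Exp (a ∷ b ∷ c ∷ d ∷ e ∷ Γ) e
v4 = var (there (there (there (there (here refl)))))

infixr 6 _∧ᵉ_
infixr 5 _∨ᵉ_
infix  7 ¬ᵉ_

_∧ᵉ_ _∨ᵉ_ : ∀ {Γ} → Exp Γ bool → Exp Γ bool → Exp Γ bool
d ∧ᵉ e = cond d e (lit false)
d ∨ᵉ e = cond d (lit true) e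

¬ᵉ_ : ∀ {Γ} → Exp Γ bool → Exp Γ bool
¬ᵉ e = cond e (lit false) (lit true)

eqᵉ : ∀ {Γ} → Exp Γ ix → Exp Γ ix → Exp Γ bool
eqᵉ i j = le i j ∧ᵉ le j i

-- The truth values are tabulated before folding: the body of a fold has the accumulator in scope,
-- and `e`, which does not, would have to be weakened.
anyᵉ allᵉ : ∀ {Γ} → Exp (ix ∷ Γ) bool → Exp Γ bool
anyᵉ e = call (fold (v2 ! v0 ∨ᵉ v1) (lit false)) (tab e ∷ [])
allᵉ e = call (fold (v2 ! v0 ∧ᵉ v1) (lit true)) (tab e ∷ [])

anyColorᵉ : ∀ {Γ} → (Color → Exp Γ bool) → Exp Γ bool
anyColorᵉ e = e left ∨ᵉ e right ∨ᵉ e cut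

-- Truth of the derived expressions

T-stable : ∀ {b} → ¬ ¬ T b → T b
T-stable {b} = decidable-stable (T? b)

T-∧ : ∀ {a b} → T (ifᵇ a then b else false) ⇔ (T a × T b)
T-∧ {true}  = mk⇔ (tt ,_) proj₂
T-∧ {false} = mk⇔ (λ ()) proj₁

T-∨ : ∀ {a b} → T (ifᵇ a then true else b) ⇔ (T a ⊎ T b)
T-∨ {true}  = mk⇔ inj₁ (λ _ → tt)
T-∨ {false} = mk⇔ inj₂ λ { (inj₁ ()) ; (inj₂ p) → p }

T-¬ : ∀ {a} → T (ifᵇ a then false else true) ⇔ (¬ T a)
T-¬ {true}  = mk⇔ (λ ()) (λ p → p tt)
T-¬ {false} = mk⇔ (λ _ ()) _

T-⇒ : ∀ {a b} → T (ifᵇ (ifᵇ a then false else true) then true else b) ⇔ (T a → T b)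
T-⇒ {true}  = mk⇔ (λ p _ → p) (λ p → p tt)
T-⇒ {false} = mk⇔ (λ _ ()) _

eqF : ∀ {n} → Fin n → Fin n → Bool
eqF i j = eval (eqᵉ v0 v1) (i ∷ j ∷ [])

T-eq : ∀ {n} {i j : Fin n} → T (eqF i j) ⇔ (i ≡ j)
T-eq {i = i} {j} = mk⇔
  (λ p → let q , r = to T-∧ p in toℕ-injective (≤-antisym (T-≤ q) (T-≤ r)))
  (λ { refl → from T-∧ (≤-T {toℕ i} ≤-refl , ≤-T {toℕ i} ≤-refl) })
  where
  T-≤ : ∀ {a b} → T ((a ∸ b) ≡ᵇ 0) → a ≤ b
  T-≤ {a} {b} p = m∸n≡0⇒m≤n (≡ᵇ⇒≡ (a ∸ b) 0 p)
  ≤-T : ∀ {a b} → a ≤ b → T ((a ∸ b) ≡ᵇ 0)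
  ≤-T {a} {b} p = ≡⇒≡ᵇ (a ∸ b) 0 (m≤n⇒m∸n≡0 p)

T-any : ∀ {n} {f : Fin n → Bool} →
  T (foldFin (λ i b → ifᵇ f i then true else b) false) ⇔ (∃ λ i → T (f i))
T-any {n} {f} = mk⇔ (to′ (allFin n)) (λ (i , p) → from′ (∈-allFin i) p)
  where
  anyOf : List (Fin n) → Bool
  anyOf = foldr (λ i b → ifᵇ f i then true else b) false
  to′ : ∀ is → T (anyOf is) → ∃ λ i → T (f i)
  to′ (i ∷ is) p = [ i ,_ , to′ is ]′ (to T-∨ p)
  from′ : ∀ {i is} → i ∈ is → T (f i) → T (anyOf is)
  from′ (here refl) p = from T-∨ (inj₁ p)
  from′ {is = j ∷ _} (there i∈) p = from (T-∨ {f j}) (inj₂ (from′ i∈ p))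

T-all : ∀ {n} {f : Fin n → Bool} →
  T (foldFin (λ i b → ifᵇ f i then b else false) true) ⇔ (∀ i → T (f i))
T-all {n} {f} = mk⇔ (λ p i → to′ (∈-allFin i) p) (λ p → from′ (allFin n) p)
  where
  allOf : List (Fin n) → Bool
  allOf = foldr (λ i b → ifᵇ f i then b else false) true
  to′ : ∀ {i is} → i ∈ is → T (allOf is) → T (f i)
  to′ (here refl) p = proj₁ (to T-∧ p)
  to′ {is = j ∷ _} (there i∈) p = to′ i∈ (proj₂ (to (T-∧ {f j}) p))
  from′ : ∀ is → (∀ i → T (f i)) → T (allOf is)
  from′ []       p = tt
  from′ (i ∷ is) p = from T-∧ (p i , from′ is p)

T-anyColor : ∀ {f : Color → Bool} →
  T (ifᵇ f left then true else (ifᵇ f right then true else f cut)) ⇔ (∃ λ c → T (f c))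
T-anyColor {f} = mk⇔
  (λ p → [ left ,_ , (λ q → [ right ,_ , cut ,_ ]′ (to (T-∨ {f right}) q)) ]′ (to (T-∨ {f left}) p))
  λ { (left , p)  → from T-∨ (inj₁ p)
    ; (right , p) → from (T-∨ {f left}) (inj₂ (from T-∨ (inj₁ p)))
    ; (cut , p)   → from (T-∨ {f left}) (inj₂ (from (T-∨ {f right}) (inj₂ p))) }

-- Lists of admissible colours and arc consistency

compatible : Color → Color → Bool
compatible left  right = false
compatible right left  = false
compatible cut   cut   = false
compatible _     _     = true

compatible-sym : ∀ {c d} → T (compatible c d) → T (compatible d c)
compatible-sym {left}  {left}  _ = tt
compatible-sym {left}  {cut}   _ = tt
compatible-sym {right} {right} _ = tt
compatible-sym {right} {cut}   _ = tt
compatible-sym {cut}   {left}  _ = tt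
compatible-sym {cut}   {right} _ = tt

_==_ : Color → Color → Bool
left  == left  = true
right == right = true
cut   == cut   = true
_     == _     = false

T-== : ∀ {c d} → T (c == d) ⇔ (c ≡ d)
T-== = mk⇔ to′ λ { refl → from′ _ }
  where
  to′ : ∀ {c d} → T (c == d) → c ≡ d
  to′ {left}  {left}  _ = refl
  to′ {right} {right} _ = refl
  to′ {cut}   {cut}   _ = refl
  from′ : ∀ c → T (c == c)
  from′ left  = tt
  from′ right = tt
  from′ cut   = tt

_≟ᶜ_ : (c d : Color) → Dec (c ≡ d)
c ≟ᶜ d with T? (c == d)
... | yes p = yes (to T-== p)
... | no ¬p = no (¬p ∘ from T-==)

anyColor? : ∀ {P : Color → Set} → (∀ c → Dec (P c)) → Dec (∃ P)
anyColor? P? with P? left | P? right | P? cut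
... | yes p | _     | _     = yes (left , p)
... | no _  | yes p | _     = yes (right , p)
... | no _  | no _  | yes p = yes (cut , p)
... | no ¬p | no ¬q | no ¬r = no λ { (left , p) → ¬p p ; (right , p) → ¬q p ; (cut , p) → ¬r p }

allColors? : ∀ {P : Color → Set} → (∀ c → Dec (P c)) → Dec (∀ c → P c)
allColors? P? with P? left | P? right | P? cut
... | yes p | yes q | yes r = yes λ { left → p ; right → q ; cut → r }
... | no ¬p | _     | _     = no λ p → ¬p (p left)
... | yes _ | no ¬q | _     = no λ p → ¬q (p right)
... | yes _ | yes _ | no ¬r = no λ p → ¬r (p cut)

vset lists rel : Ty
vset  = row bool
lists = row (cols bool)
rel   = row vset

VSet Lists Rel : ℕ → Set
VSet  = ⟦ vset ⟧
Lists = ⟦ lists ⟧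
Rel   = ⟦ rel ⟧

opaque
  pruneᵉ : Exp (lists ∷ rel ∷ []) lists
  pruneᵉ = tab (mk λ c →
    v1 ! v0 at c ∧ᵉ
    allᵉ (¬ᵉ (v3 ! v1 ! v0) ∨ᵉ anyColorᵉ λ d → lit (compatible c d) ∧ᵉ v2 ! v0 at d))

opaque
  -- Three rounds of pruning per vertex, one for each of the 3 n list entries that could be deleted.
  acᵉ : Exp (lists ∷ rel ∷ []) lists
  acᵉ = fold (again (again (again v1))) v0
    where
    again : Exp (ix ∷ lists ∷ lists ∷ rel ∷ []) lists → Exp (ix ∷ lists ∷ lists ∷ rel ∷ []) lists
    again e = call pruneᵉ (e ∷ v3 ∷ [])

prune : ∀ {n} → Rel n → Lists n → Lists n
prune E L = eval pruneᵉ (L ∷ E ∷ [])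

ac : ∀ {n} → Rel n → Lists n → Lists n
ac E L = eval acᵉ (L ∷ E ∷ [])

infix 4 _⊆ˡ_

_⊆ˡ_ : ∀ {n} → (Fin n → Color → Set) → Lists n → Set
M ⊆ˡ L = ∀ u c → M u c → T (L u c)

Members : ∀ {n} → Lists n → Fin n → Color → Set
Members L u c = T (L u c)

Supported : ∀ {n} → Rel n → (Fin n → Color → Set) → Fin n → Color → Set
Supported E M u c = ∀ w → T (E u w) → ∃ λ d → T (compatible c d) × M w d

Consistent : ∀ {n} → Rel n → (Fin n → Color → Set) → Set
Consistent E M = ∀ u c → M u c → Supported E M u c

opaque
  unfolding pruneᵉ

  T-prune : ∀ {n} (E : Rel n) L {u c} → T (prune E L u c) ⇔ (T (L u c) × Supported E (Members L) u c)
  T-prune {n} E L {u} {c} = mk⇔ to′ from′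
    where
    supporter : Fin n → Color → Bool
    supporter w d = ifᵇ compatible c d then L w d else false

    to′ : T (prune E L u c) → T (L u c) × Supported E (Members L) u c
    to′ p = proj₁ (to T-∧ p) , λ w e →
      let d , s = to (T-anyColor {supporter w}) (to (T-⇒ {E u w}) (to T-all (proj₂ (to (T-∧ {L u c}) p)) w) e)
      in d , to T-∧ s

    from′ : T (L u c) × Supported E (Members L) u c → T (prune E L u c)
    from′ (p , q) = from T-∧ (p , from T-all λ w → from (T-⇒ {E u w}) (support w))
      where
      support : ∀ w → T (E u w) → T (ifᵇ supporter w left then true else (ifᵇ supporter w right then true else supporter w cut))
      support w e = let d , r , s = q w e in from (T-anyColor {supporter w}) (d , from T-∧ (r , s))

prune-⊆ : ∀ {n} (E : Rel n) L → Members (prune E L) ⊆ˡ L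
prune-⊆ E L u c p = proj₁ (to (T-prune E L) p)

prune-greatest : ∀ {n} (E : Rel n) L {M} → Consistent E M → M ⊆ˡ L → M ⊆ˡ prune E L
prune-greatest E L con M⊆L u c p = from (T-prune E L)
  (M⊆L u c p , λ w e → let d , q , r = con u c p w e in d , q , M⊆L w d r)

prune-consistent : ∀ {n} (E : Rel n) L → Members L ⊆ˡ prune E L → Consistent E (Members L)
prune-consistent E L L⊆ u c p = proj₂ (to (T-prune E L) (L⊆ u c p))

-- Termination and correctness of arc consistency

sum : ∀ {n} → (Fin n → ℕ) → ℕ
sum {zero}  f = 0
sum {suc n} f = f zero + sum (f ∘ suc)

sum-mono : ∀ {n} {f g : Fin n → ℕ} → (∀ i → f i ≤ g i) → sum f ≤ sum g
sum-mono {zero}  f≤g = z≤n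
sum-mono {suc n} f≤g = +-mono-≤ (f≤g zero) (sum-mono (f≤g ∘ suc))

sum-mono-< : ∀ {n} {f g : Fin n → ℕ} → (∀ i → f i ≤ g i) → ∀ i → f i < g i → sum f < sum g
sum-mono-< f≤g zero    f<g = +-mono-<-≤ f<g (sum-mono (f≤g ∘ suc))
sum-mono-< f≤g (suc i) f<g = +-mono-≤-< (f≤g zero) (sum-mono-< (f≤g ∘ suc) i f<g)

sum-≤ : ∀ {n} {f : Fin n → ℕ} b → (∀ i → f i ≤ b) → sum f ≤ n * b
sum-≤ {zero}  b f≤b = z≤n
sum-≤ {suc n} b f≤b = +-mono-≤ (f≤b zero) (sum-≤ b (f≤b ∘ suc))

term≤sum : ∀ {n} (f : Fin n → ℕ) i → f i ≤ sum f
term≤sum f zero    = m≤m+n _ _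
term≤sum f (suc i) = ≤-trans (term≤sum (f ∘ suc) i) (m≤n+m _ _)

indicator : Bool → ℕ
indicator b = ifᵇ b then 1 else 0

indicator-mono : ∀ {a b} → (T a → T b) → indicator a ≤ indicator b
indicator-mono {false}        p = z≤n
indicator-mono {true} {true}  p = ≤-refl
indicator-mono {true} {false} p = ⊥-elim (p tt)

indicator-< : ∀ {a b} → ¬ T a → T b → indicator a < indicator b
indicator-< {false} {true} _ _ = s≤s z≤n
indicator-< {true}  p _ = ⊥-elim (p tt)

indicator-≤1 : ∀ b → indicator b ≤ 1
indicator-≤1 true  = ≤-refl
indicator-≤1 false = z≤n

#colors : (Color → Bool) → ℕ
#colors f = indicator (f left) + (indicator (f right) + indicator (f cut))

#colors-mono : ∀ {f g} → (∀ c → T (f c) → T (g c)) → #colors f ≤ #colors g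
#colors-mono p = +-mono-≤ (indicator-mono (p left)) (+-mono-≤ (indicator-mono (p right)) (indicator-mono (p cut)))

#colors-mono-< : ∀ {f g} → (∀ c → T (f c) → T (g c)) → ∀ c → ¬ T (f c) → T (g c) → #colors f < #colors g
#colors-mono-< p left  q r = +-mono-<-≤ (indicator-< q r) (+-mono-≤ (indicator-mono (p right)) (indicator-mono (p cut)))
#colors-mono-< p right q r = +-mono-≤-< (indicator-mono (p left)) (+-mono-<-≤ (indicator-< q r) (indicator-mono (p cut)))
#colors-mono-< p cut   q r = +-mono-≤-< (indicator-mono (p left)) (+-mono-≤-< (indicator-mono (p right)) (indicator-< q r))

#colors≡0 : ∀ f → #colors f ≤ 0 → ∀ c → ¬ T (f c)
#colors≡0 f p c q = 1+n≰n (≤-trans (≤-trans (indicator-< {false} id q) (indicator≤ c)) p)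
  where
  indicator≤ : ∀ c → indicator (f c) ≤ #colors f
  indicator≤ left  = m≤m+n _ _
  indicator≤ right = ≤-trans (m≤m+n _ _) (m≤n+m _ (indicator (f left)))
  indicator≤ cut   = ≤-trans (m≤n+m _ (indicator (f right))) (m≤n+m _ (indicator (f left)))

size# : ∀ {n} → Lists n → ℕ
size# L = sum (λ u → #colors (L u))

-- Each round either changes nothing or deletes one of the at most 3 n entries.
consistent-or-smaller : ∀ {n} (E : Rel n) L →
  Consistent E (Members L) ⊎ size# (prune E L) < size# L
consistent-or-smaller E L
  with any? (λ u → anyColor? (λ c → T? (L u c) ×-dec ¬? (T? (prune E L u c))))
... | yes (u , c , p , q) = inj₂ (sum-mono-< (λ u → #colors-mono (prune-⊆ E L u)) u (#colors-mono-< (prune-⊆ E L u) c q p))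
... | no ¬ex = inj₁ (prune-consistent E L λ u c p → T-stable λ q → ¬ex (u , c , p , q))

prune-preserves : ∀ {n} (E : Rel n) L → Consistent E (Members L) → Consistent E (Members (prune E L))
prune-preserves E L con = prune-consistent E (prune E L)
  (prune-greatest E (prune E L) con′ (λ _ _ → id))
  where
  con′ : Consistent E (Members (prune E L))
  con′ u c p w e with con u c (prune-⊆ E L u c p) w e
  ... | d , q , r = d , q , prune-greatest E L con (λ _ _ → id) w d r

-- Pruning keeps consistent lists consistent, and otherwise the number of entries drops; `k` counts
-- the rounds so far against the initial budget `m`.
prune-progress : ∀ {n} (E : Rel n) L k {m} →
  Consistent E (Members L) ⊎ size# L + k ≤ m →
  Consistent E (Members (prune E L)) ⊎ size# (prune E L) + suc k ≤ m
prune-progress E L k (inj₁ con) = inj₁ (prune-preserves E L con)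
prune-progress E L k (inj₂ p) with consistent-or-smaller E L
... | inj₁ con = inj₁ (prune-preserves E L con)
... | inj₂ q   = inj₂ (≤-trans (≤-reflexive (+-suc _ k)) (≤-trans (+-monoˡ-≤ k q) p))

module _ {n} (E : Rel n) where

  private
    rounds : Lists n → List (Fin n) → Lists n
    rounds L = foldr (λ _ L → prune E (prune E (prune E L))) L

  opaque
    unfolding acᵉ

    ac-⊆ : ∀ L → Members (ac E L) ⊆ˡ L
    ac-⊆ L = go (allFin n)
      where
      go : ∀ is → Members (rounds L is) ⊆ˡ L
      go []       u c p = p
      go (_ ∷ is) u c p = go is u c (prune-⊆ E K u c (prune-⊆ E (prune E K) u c (prune-⊆ E (prune E (prune E K)) u c p)))
        where
        K : Lists n
        K = rounds L is

    -- `M` is an arbitrary predicate because it is later instantiated both by the graph of a proper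
    -- colouring and by lists built from the complement of a possibly undecidable set.
    ac-greatest : ∀ L {M} → Consistent E M → M ⊆ˡ L → M ⊆ˡ ac E L
    ac-greatest L {M} con M⊆L = go (allFin n)
      where
      go : ∀ is → M ⊆ˡ rounds L is
      go []       = M⊆L
      go (_ ∷ is) =
        prune-greatest E (prune E (prune E K)) con (prune-greatest E (prune E K) con (prune-greatest E K con (go is)))
        where
        K : Lists n
        K = rounds L is

    ac-consistent : ∀ L → Consistent E (Members (ac E L))
    ac-consistent L with go (allFin n)
      where
      go : ∀ is → Consistent E (Members (rounds L is)) ⊎ size# (rounds L is) + length is * 3 ≤ n * 3
      go []       = inj₂ (≤-trans (≤-reflexive (+-identityʳ _)) (sum-≤ 3 #colors≤3))
        where
        #colors≤3 : ∀ u → #colors (L u) ≤ 3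
        #colors≤3 u = +-mono-≤ (indicator-≤1 (L u left))
          (+-mono-≤ (indicator-≤1 (L u right)) (indicator-≤1 (L u cut)))
      go (_ ∷ is) = prune-progress E (prune E (prune E K)) (2 + k)
        (prune-progress E (prune E K) (1 + k) (prune-progress E K k (go is)))
        where
        K : Lists n
        K = rounds L is
        k : ℕ
        k = length is * 3
    ... | inj₁ con = con
    -- If all 3 n rounds deleted an entry, no entry is left, and empty lists are vacuously
    -- consistent.
    ... | inj₂ p   = λ u c q → contradiction q (#colors≡0 (ac E L u)
            (≤-trans (term≤sum (λ u → #colors (ac E L u)) u)
              (+-cancelʳ-≤ (n * 3) (size# (ac E L)) 0 bound)) c)
      where
      bound : size# (ac E L) + n * 3 ≤ 0 + n * 3
      bound = subst (λ l → size# (ac E L) + l * 3 ≤ n * 3) (length-tabulate {n = n} id) p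

-- Reachability

-- If d is forced to be left and the other vertices of P must not be cut, arc
-- consistency excludes right exactly at the vertices reachable from d through P.
opaque
  reachᵉ : Exp (vset ∷ ix ∷ rel ∷ []) vset
  reachᵉ = call (tab (¬ᵉ (v1 ! v0 at right)))
    (call acᵉ (tab (mk λ c →
      cond (eqᵉ v0 v2) (lit (c == left)) (cond (v1 ! v0) (lit (ifᵇ c == cut then false else true)) (lit true)))
      ∷ v2 ∷ []) ∷ [])

module _ {n} (E : Rel n) where

  reach : VSet n → Fin n → VSet n
  reach P d = eval reachᵉ (P ∷ d ∷ E ∷ [])

  module _ (P : VSet n) (d : Fin n) (d∈P : T (P d)) where

    private
      init : Lists n
      init u c = ifᵇ eqF u d then c == left else (ifᵇ P u then (ifᵇ c == cut then false else true) else true)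

      R : Lists n
      R = ac E init

      opaque
        unfolding reachᵉ

        T-reach : ∀ u → T (reach P d u) ⇔ (¬ T (R u right))
        T-reach u = T-¬

      init-root : ∀ c → T (init d c) → c ≡ left
      init-root c p with eqF d d in eq
      ... | true  = to T-== p
      ... | false = ⊥-elim (subst T eq (from (T-eq {i = d}) refl))

      init-cut : ∀ u → T (P u) → ¬ T (init u cut)
      init-cut u p q with eqF u d | P u
      init-cut u p () | true | _
      init-cut u p () | false | true

      init-intro : ∀ u c → (u ≡ d → c ≡ left) → (T (P u) → c ≢ cut) → T (init u c)
      init-intro u c p q with eqF u d in eq | P u
      ... | true  | _     = from T-== (p (to T-eq (subst T (sym eq) tt)))
      ... | false | true  = from T-¬ (q tt ∘ to T-==)
      ... | false | false = tt

    reach-root : T (reach P d d)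
    reach-root = from (T-reach d) λ p → contradiction (init-root right (ac-⊆ E init d right p)) λ ()

    -- Colour `right` at `w` would need support at `u`; there `right` has been excluded, and `cut`
    -- was never allowed since `u` lies in `P`.
    reach-closed : ∀ {u w} → T (P u) → T (reach P d u) → T (E w u) → T (reach P d w)
    reach-closed {u} {w} u∈P r e = from (T-reach w) λ p → unsupported (ac-consistent E init w right p u e)
      where
      unsupported : ¬ (∃ λ c → T (compatible right c) × T (R u c))
      unsupported (right , _ , p) = to (T-reach u) r p
      unsupported (cut   , _ , p) = init-cut u u∈P (ac-⊆ E init u cut p)

    -- The lists with `left` everywhere, `right` off `Q` and `cut` off `P` are consistent, hence
    -- survive. So if `u` were off `Q`, `right` would survive at `u`.
    reach-least : (Q : Fin n → Set) → Q d → (∀ {u w} → T (P w) → Q w → T (E u w) → Q u) →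
                  ∀ {u} → T (reach P d u) → ¬ ¬ Q u
    reach-least Q d∈Q closed {u} r u∉Q = to (T-reach u) r (ac-greatest E init consistent M⊆ u right u∉Q)
      where
      M : Fin n → Color → Set
      M u left  = T true
      M u right = ¬ Q u
      M u cut   = ¬ T (P u)

      M⊆ : M ⊆ˡ init
      M⊆ u left  _ = init-intro u left (λ _ → refl) (λ _ ())
      M⊆ u right p = init-intro u right (λ { refl → ⊥-elim (p d∈Q) }) (λ _ ())
      M⊆ u cut   p = init-intro u cut (λ { refl → ⊥-elim (p d∈P) }) (λ q → ⊥-elim (p q))

      consistent : Consistent E M
      consistent u left  p w e = left , tt , tt
      consistent u cut   p w e = left , tt , tt
      consistent u right p w e with T? (P w)
      ... | yes w∈P = right , tt , λ w∈Q → p (closed w∈P w∈Q e)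
      ... | no  w∉P = cut , tt , w∉P

  reach-mono : ∀ P P′ d → T (P d) → (∀ u → T (P u) → T (P′ u)) →
               ∀ u → T (reach P d u) → T (reach P′ d u)
  reach-mono P P′ d d∈P P⊆P′ u r = T-stable (reach-least P d d∈P (λ u → T (reach P′ d u))
    (reach-root P′ d (P⊆P′ d d∈P)) (λ {_} {w} w∈P q e → reach-closed P′ d (P⊆P′ d d∈P) (P⊆P′ w w∈P) q e) r)

-- Minimal connected dominating sets

opaque
  -- Reachability through `D` also records vertices outside `D` that have a reached neighbour in
  -- `D`. For `D` inside `C`, one root reaching all of `C` therefore expresses connectedness and
  -- domination at once.
  cdsᵉ : Exp (vset ∷ vset ∷ rel ∷ []) bool
  cdsᵉ = anyᵉ (v1 ! v0 ∧ᵉ allᵉ (¬ᵉ (v3 ! v0) ∨ᵉ call reachᵉ (v2 ∷ v1 ∷ v4 ∷ []) ! v0))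

opaque
  complementᵉ : Exp (vset ∷ []) vset
  complementᵉ = tab (¬ᵉ (v1 ! v0))

opaque
  -- The first conjunct makes the component of a vertex of `X` empty; the second removes the
  -- neighbours in `X` that reachability through the complement picks up.
  componentᵉ : Exp (vset ∷ ix ∷ rel ∷ []) vset
  componentᵉ = tab (¬ᵉ (v1 ! v2) ∧ᵉ ¬ᵉ (v1 ! v0) ∧ᵉ
    call reachᵉ (call complementᵉ (v1 ∷ []) ∷ v2 ∷ v3 ∷ []) ! v0)

opaque
  deleteᵉ : Exp (ix ∷ vset ∷ []) vset
  deleteᵉ = tab (v2 ! v0 ∧ᵉ ¬ᵉ eqᵉ v0 v1)

opaque
  minimizeᵉ : Exp (vset ∷ rel ∷ []) vset
  minimizeᵉ = fold
    (call (cond (call cdsᵉ (v0 ∷ v2 ∷ v3 ∷ [])) v0 v1)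
      (call deleteᵉ (v0 ∷ v1 ∷ []) ∷ v1 ∷ v2 ∷ v3 ∷ [])) v0

∁ : ∀ {n} → VSet n → VSet n
∁ P = eval complementᵉ (P ∷ [])

opaque
  unfolding complementᵉ

  T-∁ : ∀ {n} {P : VSet n} {u} → T (∁ P u) ⇔ (¬ T (P u))
  T-∁ = T-¬

delete : ∀ {n} → Fin n → VSet n → VSet n
delete v D = eval deleteᵉ (v ∷ D ∷ [])

opaque
  unfolding deleteᵉ

  T-delete : ∀ {n v} (D : VSet n) {u} → T (delete v D u) ⇔ (T (D u) × u ≢ v)
  T-delete {v = v} D {u} = mk⇔
    (λ p → let q , r = to T-∧ p in q , to (T-¬ {eqF u v}) r ∘ from T-eq)
    (λ (p , q) → from T-∧ (p , from (T-¬ {eqF u v}) (q ∘ to T-eq)))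

module _ {n} (E : Rel n) where

  cds : VSet n → VSet n → Bool
  cds D C = eval cdsᵉ (D ∷ C ∷ E ∷ [])

  component : VSet n → Fin n → VSet n
  component X r = eval componentᵉ (X ∷ r ∷ E ∷ [])

  minimize : VSet n → VSet n
  minimize C = eval minimizeᵉ (C ∷ E ∷ [])

  opaque
    unfolding cdsᵉ

    T-cds : ∀ D C → T (cds D C) ⇔ (∃ λ d → T (D d) × (∀ u → T (C u) → T (reach E D d u)))
    T-cds D C = mk⇔
      (λ p → let d , q = to T-any p ; r , s = to T-∧ q in d , r , λ u → to (T-⇒ {C u}) (to T-all s u))
      (λ (d , r , s) → from T-any (d , from T-∧ (r , from T-all (λ u → from (T-⇒ {C u}) (s u)))))

  opaque
    unfolding componentᵉ complementᵉ

    T-component : ∀ X r {u} →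
      T (component X r u) ⇔ (¬ T (X r) × ¬ T (X u) × T (reach E (∁ X) r u))
    T-component X r {u} = mk⇔
      (λ p → let q , s = to T-∧ p ; s′ , t = to (T-∧ {ifᵇ X u then false else true}) s in
        to T-¬ q , to T-¬ s′ , t)
      (λ (p , q , s) → from T-∧ (from T-¬ p , from (T-∧ {ifᵇ X u then false else true}) (from T-¬ q , s)))

  cds-mono : ∀ D D′ C → (∀ u → T (D u) → T (D′ u)) → T (cds D C) → T (cds D′ C)
  cds-mono D D′ C D⊆D′ p with to (T-cds D C) p
  ... | d , d∈D , r = from (T-cds D′ C) (d , D⊆D′ d d∈D , λ u u∈C → reach-mono E D D′ d d∈D D⊆D′ u (r u u∈C))

  record Minimal (C D : VSet n) : Set where
    field
      subset    : ∀ {u} → T (D u) → T (C u)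
      cds-valid : T (cds C C) → T (cds D C)
      minimal   : ∀ {v} → T (D v) → ¬ T (cds (delete v D) C)

  opaque
    unfolding minimizeᵉ

    -- Trying each vertex once is enough: `cds` is monotone in `D`, so a deletion that failed
    -- earlier still fails after further deletions.
    minimize-minimal : ∀ C → Minimal C (minimize C)
    minimize-minimal C = let p , q , r = go (allFin n) in
      record { subset = p ; cds-valid = q ; minimal = λ {v} → r (∈-allFin v) }
      where
      candidate : Fin n → VSet n → VSet n
      candidate v D = ifᵇ cds (delete v D) C then delete v D else D

      go : ∀ vs → let D = foldr candidate C vs in
        (∀ {u} → T (D u) → T (C u)) × (T (cds C C) → T (cds D C)) ×
        (∀ {v} → v ∈ vs → T (D v) → ¬ T (cds (delete v D) C))
      go [] = id , id , λ ()
      go (v ∷ vs) with foldr candidate C vs | go vs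
      ... | D | p , q , r with cds (delete v D) C in eq
      ...   | false = p , q , λ { (here refl) _ s → subst T eq s ; (there i) → r i }
      ...   | true  = p ∘ proj₁ ∘ to (T-delete D) , (λ _ → subst T (sym eq) tt)
        , λ { (here refl) v∈ _ → proj₂ (to (T-delete D) v∈) refl
            ; {v′} (there i) v∈ s → r i (proj₁ (to (T-delete D) v∈)) (cds-mono (delete v′ (delete v D)) (delete v′ D) C
                (λ u u∈ → let u∈′ , ne = to (T-delete (delete v D)) u∈
                        in from (T-delete D) (proj₁ (to (T-delete D) u∈′) , ne)) s) }

-- The polynomial-time part

opaque
  assignᵉ : Color → Exp (ix ∷ lists ∷ []) lists
  assignᵉ c = tab (mk λ d → v2 ! v0 at d ∧ᵉ (¬ᵉ eqᵉ v0 v1 ∨ᵉ lit (d == c)))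

opaque
  guessᵉ : Color → Color → Color → Exp (lists ∷ vset ∷ ix ∷ ix ∷ []) lists
  guessᵉ a b c = tab (mk λ d → v1 ! v0 at d ∧ᵉ (¬ᵉ (v2 ! v0) ∨ᵉ
    cond (eqᵉ v0 v3) (lit (d == a)) (cond (eqᵉ v0 v4) (lit (d == b)) (lit (d == c)))))

opaque
  nonemptyᵉ : Exp (lists ∷ []) bool
  nonemptyᵉ = allᵉ (anyColorᵉ λ c → v1 ! v0 at c)

opaque
  twoSatᵉ : Exp (lists ∷ rel ∷ []) bool
  twoSatᵉ = allᵉ (anyColorᵉ λ c →
    call nonemptyᵉ (call acᵉ (call (assignᵉ c) (v0 ∷ v1 ∷ []) ∷ v2 ∷ []) ∷ []))

opaque
  extendableᵉ : Exp (lists ∷ vset ∷ rel ∷ []) bool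
  extendableᵉ = anyᵉ (anyᵉ (anyColorᵉ λ a → anyColorᵉ λ b → anyColorᵉ λ c →
    call twoSatᵉ (call acᵉ (call (guessᵉ a b c) (v2 ∷ v3 ∷ v0 ∷ v1 ∷ []) ∷ v4 ∷ []) ∷ v4 ∷ [])))

opaque
  -- Ranging over all vertices `r` spares a choice of representatives: several `r` may stand for one
  -- component, and an `r` in `X` stands for the empty set.
  allExtendableᵉ : Exp (lists ∷ vset ∷ rel ∷ []) bool
  allExtendableᵉ = allᵉ (call extendableᵉ
    (v1 ∷ call minimizeᵉ (call componentᵉ (v2 ∷ v0 ∷ v3 ∷ []) ∷ v3 ∷ []) ∷ v3 ∷ []))

opaque
  solveᵉ : Exp (lists ∷ vset ∷ rel ∷ []) bool
  solveᵉ = anyᵉ (anyᵉ (call allExtendableᵉ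
    (call (assignᵉ right) (v0 ∷ call (assignᵉ left) (v1 ∷ v2 ∷ []) ∷ []) ∷ v3 ∷ v4 ∷ [])))

assign : ∀ {n} → Color → Fin n → Lists n → Lists n
assign c v L = eval (assignᵉ c) (v ∷ L ∷ [])

guess : ∀ {n} → Color → Color → Color → Lists n → VSet n → Fin n → Fin n → Lists n
guess a b c L D v w = eval (guessᵉ a b c) (L ∷ D ∷ v ∷ w ∷ [])

opaque
  unfolding assignᵉ

  T-assign : ∀ {n} c v (L : Lists n) {u d} → T (assign c v L u d) ⇔ (T (L u d) × (u ≡ v → d ≡ c))
  T-assign c v L {u} {d} = mk⇔
    (λ p → let q , r = to T-∧ p in q , λ e → to T-== (to (T-⇒ {eqF u v}) r (from T-eq e)))
    (λ (p , q) → from T-∧ (p , from (T-⇒ {eqF u v}) λ e → from T-== (q (to T-eq e))))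

opaque
  unfolding guessᵉ

  guess-⊆ : ∀ {n} a b c (L : Lists n) D v w → Members (guess a b c L D v w) ⊆ˡ L
  guess-⊆ a b c L D v w u d p = proj₁ (to (T-∧ {L u d}) p)

opaque
  unfolding guessᵉ

  guess-unique : ∀ {n} a b c (L : Lists n) D v w {u} → T (D u) →
    ∃ λ e → ∀ {d} → T (guess a b c L D v w u d) → d ≡ e
  guess-unique a b c L D v w {u} u∈D with D u
  ... | true with eqF u v | eqF u w
  ...   | true  | _     = a , λ {d} p → to T-== (proj₂ (to (T-∧ {L u d}) p))
  ...   | false | true  = b , λ {d} p → to T-== (proj₂ (to (T-∧ {L u d}) p))
  ...   | false | false = c , λ {d} p → to T-== (proj₂ (to (T-∧ {L u d}) p))

opaque
  unfolding guessᵉ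

  guess-intro : ∀ {n} (φ : Fin n → Color) (L : Lists n) D v w c →
    (∀ u → T (L u (φ u))) → (∀ u → T (D u) → u ≡ v ⊎ u ≡ w ⊎ φ u ≡ c) →
    ∀ u → T (guess (φ v) (φ w) c L D v w u (φ u))
  guess-intro φ L D v w c φ∈L p u = from T-∧ (φ∈L u , from (T-⇒ {D u}) λ u∈D → body (p u u∈D))
    where
    body : u ≡ v ⊎ u ≡ w ⊎ φ u ≡ c →
      T (ifᵇ eqF u v then φ u == φ v else (ifᵇ eqF u w then φ u == φ w else φ u == c))
    body q with eqF u v in eq | eqF u w in eq′
    ... | true  | _     = from T-== (cong φ (to T-eq (subst T (sym eq) tt)))
    ... | false | true  = from T-== (cong φ (to T-eq (subst T (sym eq′) tt)))
    body (inj₁ refl)        | false | false = ⊥-elim (subst T eq (from (T-eq {i = u}) refl))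
    body (inj₂ (inj₁ refl)) | false | false = ⊥-elim (subst T eq′ (from (T-eq {i = u}) refl))
    body (inj₂ (inj₂ r))    | false | false = from T-== r

-- Minimal connected dominating sets without induced `P₅`

module _ {n : ℕ} (E : Rel n)
  (E-sym : ∀ {u w} → T (E u w) → T (E w u)) (E-irrefl : ∀ {u} → ¬ T (E u u)) where

  infix 4 _~_ _≁_

  _~_ _≁_ : Fin n → Fin n → Set
  u ~ w = T (E u w)
  u ≁ w = ¬ (u ~ w)

  ~⇒≢ : ∀ {u w} → u ~ w → u ≢ w
  ~⇒≢ e refl = E-irrefl e

  ≁-sym : ∀ {u w} → u ≁ w → w ≁ u
  ≁-sym ne e = ne (E-sym e)

  -- Quantifying over all, possibly undecidable, sets Q costs a double negation.
  ConnectedIn : VSet n → Set₁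
  ConnectedIn D = (Q : Fin n → Set) → ∀ {d} → T (D d) → Q d →
    (∀ {u w} → T (D u) → T (D w) → Q w → u ~ w → ¬ ¬ Q u) → ∀ {u} → T (D u) → ¬ ¬ Q u

  -- If `Q` missed `u`, the root `d` could not satisfy `Q`, which would spread from it to `u`. But
  -- then, edges being symmetric, failing `Q` spreads from the root to `e`.
  reach⇒connected : ∀ {D d} → T (D d) → (∀ {u} → T (D u) → T (reach E D d u)) → ConnectedIn D
  reach⇒connected {D} {d} d∈D reached Q {e} e∈D e∈Q closed {u} u∈D u∉Q =
    reach-least E D d d∈D (λ w → T (D w) → ¬ Q w)
      (λ _ d∈Q → reach-least E D d d∈D (λ w → T (D w) → ¬ ¬ Q w) (λ _ k → k d∈Q)
        (λ w∈D q e u∈D k → q w∈D λ w∈Q → closed u∈D w∈D w∈Q e k)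
        (reached u∈D) λ q → q u∈D u∉Q)
      (λ w∈D q e u∈D u∈Q → closed w∈D u∈D u∈Q (E-sym e) (q w∈D))
      (reached e∈D) λ q → q e∈D e∈Q

  NoInducedP₅ : VSet n → Set
  NoInducedP₅ C = ∀ {a b c d e} → T (C a) → T (C b) → T (C c) → T (C d) → T (C e) →
    a ~ b → b ~ c → c ~ d → d ~ e → a ≁ c → a ≁ d → a ≁ e → b ≁ d → b ≁ e → c ≁ e → ⊥

  module _ (C D : VSet n) (D-minimal : Minimal E C D) (D-cds : T (cds E D C)) where

    open Minimal D-minimal

    private
      _∈D : Fin n → Set
      u ∈D = T (D u)

      root : Fin n
      root = proj₁ (to (T-cds E D C) D-cds)

      root∈D : root ∈D
      root∈D = proj₁ (proj₂ (to (T-cds E D C) D-cds))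

      reached : ∀ {u} → T (C u) → T (reach E D root u)
      reached {u} = proj₂ (proj₂ (to (T-cds E D C) D-cds)) u

    D-connected : ConnectedIn D
    D-connected = reach⇒connected root∈D (reached ∘ subset)

    D-dominating : ∀ {u} → T (C u) → ¬ ¬ (u ∈D ⊎ ∃ λ w → w ∈D × u ~ w)
    D-dominating u∈C = reach-least E D root root∈D (λ u → u ∈D ⊎ ∃ λ w → w ∈D × u ~ w)
      (inj₁ root∈D) (λ w∈D _ e → inj₂ (_ , w∈D , e)) (reached u∈C)

    record Private (x p : Fin n) : Set where
      field
        member : T (C p)
        edge   : p ~ x
        only   : ∀ {w} → w ∈D → p ~ w → w ≡ x

      nonedge : ∀ {w} → w ∈D → w ≢ x → p ≁ w
      nonedge w∈D w≢x e = w≢x (only w∈D e)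

    module _ {x d} (x∈D : x ∈D) (d∈D : d ∈D) (d≢x : d ≢ x) (con : ConnectedIn (delete x D)) where

      private
        D-x : VSet n
        D-x = delete x D

        d∈D-x : T (D-x d)
        d∈D-x = from (T-delete D) (d∈D , d≢x)

      -- As `D` stays connected without `x`, minimality can only fail through domination: some
      -- vertex of `C` has `x` as its sole neighbour in `D`.
      private-neighbour : ¬ ¬ ∃ (Private x)
      private-neighbour none =
        minimal x∈D (from (T-cds E D-x C) (d , d∈D-x , λ u u∈C → T-stable (escape u∈C)))
        where
        escape : ∀ {u} → T (C u) → ¬ ¬ T (reach E D-x d u)
        escape {u} u∈C u∉R = D-dominating u∈C λ
          { (inj₁ u∈D) → inside u∈D
          ; (inj₂ (w , w∈D , e)) → outside w∈D e }
          where
          far : ∀ {w} → w ∈D → w ≢ x → u ≁ w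
          far {w} w∈D w≢x e = con (λ w → T (reach E D-x d w)) d∈D-x (reach-root E D-x d d∈D-x)
            (λ _ w∈ r e k → k (reach-closed E D-x d d∈D-x w∈ r e))
            (from (T-delete D) (w∈D , w≢x))
            λ r → u∉R (reach-closed E D-x d d∈D-x (from (T-delete D) (w∈D , w≢x)) r e)

          u-not-in-D-x : u ∈D → u ≢ x → ⊥
          u-not-in-D-x u∈D u≢x = con (λ w → T (reach E D-x d w)) d∈D-x (reach-root E D-x d d∈D-x)
            (λ _ w∈ r e k → k (reach-closed E D-x d d∈D-x w∈ r e))
            (from (T-delete D) (u∈D , u≢x)) u∉R

          inside : u ∈D → ⊥
          inside u∈D with u ≟ x
          ... | no u≢x   = u-not-in-D-x u∈D u≢x
          -- Here `u` is `x`. It has no other neighbour in `D`, so the property of differing from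
          -- `u` would spread along `D` from `d` to `u` itself.
          ... | yes refl = D-connected (_≢ u) d∈D d≢x
                (λ v∈D w∈D w≢x e k → k λ { refl → far w∈D w≢x e }) x∈D λ u≢u → u≢u refl

          outside : ∀ {w} → w ∈D → u ~ w → ⊥
          outside {w} w∈D e with w ≟ x
          ... | no w≢x   = far w∈D w≢x e
          ... | yes refl = none (u , record { member = u∈C ; edge = e ; only = only′ })
            where
            only′ : ∀ {v} → v ∈D → u ~ v → v ≡ x
            only′ v∈D e = decidable-stable (_ ≟ x) λ v≢x → far v∈D v≢x e

    AtMostThree : Set
    AtMostThree = ∃ λ x → ∃₂ λ y m → ∀ {u} → u ∈D → u ≡ x ⊎ u ≡ y ⊎ u ≡ m

    module _ (P₅-free : NoInducedP₅ C) where

      record Nonadjacent (x y : Fin n) : Set where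
        field
          {x′ y′}       : Fin n
          x∈D           : x ∈D
          y∈D           : y ∈D
          x≢y           : x ≢ y
          x≁y           : x ≁ y
          x-private     : Private x x′
          y-private     : Private y y′

        module PX = Private x-private
        module PY = Private y-private

        x∈C : T (C x)
        x∈C = subset x∈D
        y∈C : T (C y)
        y∈C = subset y∈D

        -- The vertices of `D` within distance two of `x` are closed under adjacency in `D`: a
        -- vertex `u` at distance three gives the induced path `x′ x a w u`.
        common-neighbour : ¬ ¬ ∃ λ m → m ∈D × m ~ x × m ~ y
        common-neighbour none = D-connected Q x∈D (inj₁ refl) closed y∈D λ
          { (inj₁ y≡x) → x≢y (sym y≡x)
          ; (inj₂ (inj₁ y~x)) → x≁y (E-sym y~x)
          ; (inj₂ (inj₂ (a , a∈D , a~x , y~a))) → none (a , a∈D , a~x , E-sym y~a) }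
          where
          Q : Fin n → Set
          Q u = u ≡ x ⊎ u ~ x ⊎ ∃ λ a → a ∈D × a ~ x × u ~ a

          closed : ∀ {u w} → u ∈D → w ∈D → Q w → u ~ w → ¬ ¬ Q u
          closed u∈D w∈D (inj₁ refl)       e k = k (inj₂ (inj₁ e))
          closed u∈D w∈D (inj₂ (inj₁ w~x)) e k = k (inj₂ (inj₂ (_ , w∈D , w~x , e)))
          closed {u} {w} u∈D w∈D (inj₂ (inj₂ (a , a∈D , a~x , w~a))) e k =
            P₅-free PX.member x∈C (subset a∈D) (subset w∈D) (subset u∈D)
              PX.edge (E-sym a~x) (E-sym w~a) (E-sym e)
              (PX.nonedge a∈D (~⇒≢ a~x)) (PX.nonedge w∈D w≢x) (PX.nonedge u∈D u≢x)
              (≁-sym w≁x) (≁-sym u≁x) (λ a~u → k (inj₂ (inj₂ (a , a∈D , a~x , E-sym a~u))))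
            where
            u≁x : u ≁ x
            u≁x u~x = k (inj₂ (inj₁ u~x))
            w≁x : w ≁ x
            w≁x w~x = k (inj₂ (inj₂ (w , w∈D , w~x , e)))
            w≢x : w ≢ x
            w≢x refl = u≁x e
            u≢x : u ≢ x
            u≢x refl = k (inj₁ refl)

        -- Otherwise `x′ x m y y′` is induced for a common neighbour `m`.
        privates-adjacent : ¬ ¬ (x′ ~ y′)
        privates-adjacent x′≁y′ = common-neighbour λ (m , m∈D , m~x , m~y) →
          P₅-free PX.member x∈C (subset m∈D) y∈C PY.member
            PX.edge (E-sym m~x) m~y (E-sym PY.edge)
            (PX.nonedge m∈D (~⇒≢ m~x)) (PX.nonedge y∈D (x≢y ∘ sym)) x′≁y′
            x≁y (≁-sym (PY.nonedge x∈D x≢y)) (≁-sym (PY.nonedge m∈D (~⇒≢ m~y)))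

        -- Otherwise `z m x x′ y′` is induced.
        common-extends : ∀ {m z} → m ∈D → m ~ x → m ~ y → z ∈D → z ~ m → z ≢ x → z ≢ y → ¬ (z ≁ x)
        common-extends m∈D m~x m~y z∈D z~m z≢x z≢y z≁x = privates-adjacent λ x′~y′ →
          P₅-free (subset z∈D) (subset m∈D) x∈C PX.member PY.member
            z~m m~x (E-sym PX.edge) x′~y′
            z≁x (≁-sym (PX.nonedge z∈D z≢x)) (≁-sym (PY.nonedge z∈D z≢y))
            (≁-sym (PX.nonedge m∈D (~⇒≢ m~x))) (≁-sym (PY.nonedge m∈D (~⇒≢ m~y)))
            (≁-sym (PY.nonedge x∈D x≢y))

        -- Otherwise `u x x′ y′ y` is induced.
        neighbour-common : ∀ {u} → u ∈D → u ~ x → ¬ (u ≁ y)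
        neighbour-common {u} u∈D u~x u≁y with u ≟ y
        ... | yes refl = x≁y (E-sym u~x)
        ... | no u≢y = privates-adjacent λ x′~y′ →
          P₅-free (subset u∈D) x∈C PX.member PY.member y∈C
            u~x (E-sym PX.edge) x′~y′ PY.edge
            (≁-sym (PX.nonedge u∈D (~⇒≢ u~x))) (≁-sym (PY.nonedge u∈D u≢y)) u≁y
            (≁-sym (PY.nonedge x∈D x≢y)) x≁y (PX.nonedge y∈D (x≢y ∘ sym))

      nonadjacent-sym : ∀ {x y} → Nonadjacent x y → Nonadjacent y x
      nonadjacent-sym N = record
        { x∈D = y∈D ; y∈D = x∈D ; x≢y = x≢y ∘ sym ; x≁y = ≁-sym x≁y
        ; x-private = y-private ; y-private = x-private }
        where open Nonadjacent N

      -- Otherwise `y m₁ x x′ p` is induced.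
      private-to-left : ∀ {x y p} (N : Nonadjacent x y) {m₁ m₂} → m₁ ∈D → m₂ ∈D → m₁ ≢ m₂ →
        m₁ ~ x → m₁ ~ y → m₂ ~ x → m₂ ~ y → Private m₂ p → p ≁ Nonadjacent.x′ N
      private-to-left N m₁∈D m₂∈D m₁≢m₂ m₁~x m₁~y m₂~x m₂~y P p~x′ =
        P₅-free y∈C (subset m₁∈D) x∈C PX.member P.member
          (E-sym m₁~y) m₁~x (E-sym PX.edge) (E-sym p~x′)
          (≁-sym x≁y) (≁-sym (PX.nonedge y∈D (x≢y ∘ sym))) (≁-sym (P.nonedge y∈D (~⇒≢ (E-sym m₂~y))))
          (≁-sym (PX.nonedge m₁∈D (~⇒≢ m₁~x))) (≁-sym (P.nonedge m₁∈D m₁≢m₂))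
          (≁-sym (P.nonedge x∈D (~⇒≢ (E-sym m₂~x))))
        where
        open Nonadjacent N
        module P = Private P

      module _ {x y} (N : Nonadjacent x y) where

        open Nonadjacent N
        private module N′ = Nonadjacent (nonadjacent-sym N)

        data Shape (u : Fin n) : Set where
          first  : u ≡ x → Shape u
          second : u ≡ y → Shape u
          common : u ~ x → u ~ y → Shape u

        -- The three shapes are closed under adjacency in `D`: `neighbour-common` treats neighbours
        -- of `x` and `y`, and `common-extends`, applied from both ends, treats neighbours of a
        -- common neighbour.
        shape : ∀ {u} → u ∈D → ¬ ¬ Shape u
        shape = D-connected Shape x∈D (first refl) closed
          where
          closed : ∀ {u w} → u ∈D → w ∈D → Shape w → u ~ w → ¬ ¬ Shape u
          closed u∈D w∈D (first refl)  e k = neighbour-common u∈D e λ u~y → k (common e u~y)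
          closed u∈D w∈D (second refl) e k = N′.neighbour-common u∈D e λ u~x → k (common u~x e)
          closed {u} u∈D w∈D (common w~x w~y) e k with u ≟ x | u ≟ y
          ... | yes u≡x | _       = k (first u≡x)
          ... | no _    | yes u≡y = k (second u≡y)
          ... | no u≢x  | no u≢y  =
            common-extends w∈D w~x w~y u∈D e u≢x u≢y λ u~x →
            N′.common-extends w∈D w~y w~x u∈D e u≢y u≢x λ u~y → k (common u~x u~y)

        -- `m₁` holds `D` together without `m₂`, so `m₂` has a private neighbour `p`, and
        -- `p m₂ x x′ y′` is induced.
        common-unique : ∀ {m₁ m₂} → m₁ ∈D → m₂ ∈D → m₁ ~ x → m₁ ~ y → m₂ ~ x → m₂ ~ y → ¬ (m₁ ≢ m₂)
        common-unique {m₁} {m₂} m₁∈D m₂∈D m₁~x m₁~y m₂~x m₂~y m₁≢m₂ =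
          privates-adjacent λ x′~y′ →
          private-neighbour m₂∈D x∈D (~⇒≢ (E-sym m₂~x)) con λ (p , P) → let module P = Private P in
          P₅-free P.member (subset m₂∈D) x∈C PX.member PY.member
            P.edge m₂~x (E-sym PX.edge) x′~y′
            (P.nonedge x∈D (~⇒≢ (E-sym m₂~x)))
            (private-to-left N m₁∈D m₂∈D m₁≢m₂ m₁~x m₁~y m₂~x m₂~y P)
            (private-to-left (nonadjacent-sym N) m₁∈D m₂∈D m₁≢m₂ m₁~y m₁~x m₂~y m₂~x P)
            (≁-sym (PX.nonedge m₂∈D (~⇒≢ m₂~x))) (≁-sym (PY.nonedge m₂∈D (~⇒≢ m₂~y)))
            (≁-sym (PY.nonedge x∈D x≢y))
          where
          con : ConnectedIn (delete m₂ D)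
          con Q {d} d∈ d∈Q closed {u} u∈ u∉Q = shape (proj₁ (to (T-delete D) d∈)) λ
            { (first refl)  → from-x d∈Q
            ; (second refl) → closed m₁∈ d∈ d∈Q m₁~y λ m₁∈Q → closed x∈ m₁∈ m₁∈Q (E-sym m₁~x) from-x
            ; (common d~x _) → closed x∈ d∈ d∈Q (E-sym d~x) from-x }
            where
            x∈ : T (delete m₂ D x)
            x∈ = from (T-delete D) (x∈D , ~⇒≢ (E-sym m₂~x))
            m₁∈ : T (delete m₂ D m₁)
            m₁∈ = from (T-delete D) (m₁∈D , m₁≢m₂)
            from-x : ¬ Q x
            from-x x∈Q = shape (proj₁ (to (T-delete D) u∈)) λ
              { (first refl)  → u∉Q x∈Q
              ; (second refl) → closed m₁∈ x∈ x∈Q m₁~x λ m₁∈Q → closed u∈ m₁∈ m₁∈Q (E-sym m₁~y) u∉Q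
              ; (common u~x _) → closed u∈ x∈ x∈Q u~x u∉Q }

      nonadjacent⇒atMostThree : ∀ {x y} → Nonadjacent x y → ¬ ¬ AtMostThree
      nonadjacent⇒atMostThree {x} {y} N k = common-neighbour λ (m , m∈D , m~x , m~y) →
        k (x , y , m , λ u∈D → decidable-stable (_ ≟ x ⊎-dec _ ≟ y ⊎-dec _ ≟ m) λ no-shape →
          shape N u∈D λ
            { (first u≡x)  → no-shape (inj₁ u≡x)
            ; (second u≡y) → no-shape (inj₂ (inj₁ u≡y))
            ; (common u~x u~y) → common-unique N u∈D m∈D u~x u~y m~x m~y λ u≡m → no-shape (inj₂ (inj₂ u≡m)) })
        where open Nonadjacent N

      nonadjacent : ∀ {x y} → x ∈D → y ∈D → x ≢ y → x ≁ y →
        ConnectedIn (delete x D) → ConnectedIn (delete y D) → ¬ ¬ AtMostThree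
      nonadjacent x∈D y∈D x≢y x≁y conx cony k =
        private-neighbour x∈D y∈D (x≢y ∘ sym) conx λ (_ , PX) →
        private-neighbour y∈D x∈D x≢y cony λ (_ , PY) →
        nonadjacent⇒atMostThree (record
          { x∈D = x∈D ; y∈D = y∈D ; x≢y = x≢y ; x≁y = x≁y ; x-private = PX ; y-private = PY }) k

      -- The sides of a cut vertex `v` of `D`. Neither need be connected, so one may be a single
      -- component and the other all the rest.
      record Separation (v : Fin n) (A B : Fin n → Set) : Set where
        field
          A⊆D     : ∀ {a} → A a → a ∈D
          B⊆D     : ∀ {b} → B b → b ∈D
          v∉A     : ∀ {a} → A a → a ≢ v
          v∉B     : ∀ {b} → B b → b ≢ v
          disjoint : ∀ {u} → A u → ¬ B u
          covered : ∀ {u} → u ∈D → u ≡ v ⊎ A u ⊎ B u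
          no-edge : ∀ {a b} → A a → B b → a ≁ b
          A-inhabited : ∃ A
          B-inhabited : ∃ B

      separation-sym : ∀ {v A B} → Separation v A B → Separation v B A
      separation-sym S = record
        { A⊆D = B⊆D ; B⊆D = A⊆D ; v∉A = v∉B ; v∉B = v∉A
        ; disjoint = λ b a → disjoint a b
        ; covered = λ u∈D → [ inj₁ , [ inj₂ ∘ inj₂ , inj₂ ∘ inj₁ ]′ ]′ (covered u∈D)
        ; no-edge = λ b a → ≁-sym (no-edge a b)
        ; A-inhabited = B-inhabited ; B-inhabited = A-inhabited }
        where open Separation S

      module _ {v} (v∈D : v ∈D) where

        -- Every vertex still reaches `v` without `x`: those of `A` by an edge, those of `B` along a
        -- walk in `D`, which can leave `B` only through `v`.
        complete⇒noncut : ∀ {A B} → Separation v A B → (∀ {a} → A a → a ~ v) →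
          ∀ {x} → A x → ConnectedIn (delete x D)
        complete⇒noncut {A} {B} S complete {x} Ax Q {d} d∈ d∈Q closed {u} u∈ u∉Q =
          reach-v λ v∈Q →
          D-connected (λ w → w ≡ x ⊎ w ≢ x × Q w) v∈D (inj₂ (v≢x , v∈Q)) from-v
            (proj₁ (to (T-delete D) u∈)) λ
              { (inj₁ u≡x) → proj₂ (to (T-delete D) u∈) u≡x
              ; (inj₂ (_ , u∈Q)) → u∉Q u∈Q }
          where
          open Separation S

          v≢x : v ≢ x
          v≢x = v∉A Ax ∘ sym

          remaining : ∀ {w} → w ∈D → w ≢ x → T (delete x D w)
          remaining w∈D w≢x = from (T-delete D) (w∈D , w≢x)

          reach-v : ¬ ¬ Q v
          reach-v v∉Q with covered (proj₁ (to (T-delete D) d∈))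
          ... | inj₁ refl      = v∉Q d∈Q
          ... | inj₂ (inj₁ Ad) = closed (remaining v∈D v≢x) d∈ d∈Q (E-sym (complete Ad)) v∉Q
          ... | inj₂ (inj₂ Bd) = D-connected (λ w → B w × w ≢ x × Q w)
              (proj₁ (to (T-delete D) d∈)) (Bd , proj₂ (to (T-delete D) d∈) , d∈Q) inside v∈D
              λ (Bv , _) → v∉B Bv refl
            where
            inside : ∀ {u w} → u ∈D → w ∈D → B w × w ≢ x × Q w → u ~ w → ¬ ¬ (B u × u ≢ x × Q u)
            inside {u} u∈D w∈D (Bw , w≢x , w∈Q) e k with covered u∈D
            ... | inj₁ refl      = closed (remaining v∈D v≢x) (remaining w∈D w≢x) w∈Q e v∉Q
            ... | inj₂ (inj₁ Au) = no-edge Au Bw e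
            ... | inj₂ (inj₂ Bu) with u ≟ x
            ...   | yes refl = no-edge Ax Bw e
            ...   | no u≢x   = closed (remaining u∈D u≢x) (remaining w∈D w≢x) w∈Q e λ u∈Q → k (Bu , u≢x , u∈Q)

          from-v : ∀ {u w} → u ∈D → w ∈D → w ≡ x ⊎ w ≢ x × Q w → u ~ w → ¬ ¬ (u ≡ x ⊎ u ≢ x × Q u)
          from-v {u} u∈D w∈D s e k with u ≟ x
          ... | yes u≡x = k (inj₁ u≡x)
          from-v u∈D w∈D (inj₂ (w≢x , w∈Q)) e k | no u≢x =
            closed (remaining u∈D u≢x) (remaining w∈D w≢x) w∈Q e λ u∈Q → k (inj₂ (u≢x , u∈Q))
          from-v u∈D w∈D (inj₁ refl) e k | no u≢x with covered u∈D
          ... | inj₁ refl      = reach-v λ v∈Q → k (inj₂ (u≢x , v∈Q))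
          ... | inj₂ (inj₁ Au) = reach-v λ v∈Q →
                closed (remaining u∈D u≢x) (remaining v∈D v≢x) v∈Q (complete Au) λ u∈Q → k (inj₂ (u≢x , u∈Q))
          ... | inj₂ (inj₂ Bu) = no-edge Ax Bu (E-sym e)

        Mixed : (Fin n → Set) → Set
        Mixed A = ∃₂ λ a a′ → A a × A a′ × a ~ v × a′ ≁ v × a ~ a′

        -- Without a mixed pair, `v`, `B` and the neighbours of `v` in `A` are closed under
        -- adjacency in `D`, hence exhaust `D`.
        complete-or-mixed : ∀ {A B} → Separation v A B → ¬ Mixed A → ∀ {a} → A a → a ~ v
        complete-or-mixed {A} {B} S not-mixed {a} Aa = T-stable λ a≁v →
          D-connected (λ w → w ≡ v ⊎ B w ⊎ A w × w ~ v) v∈D (inj₁ refl) closed (A⊆D Aa) λ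
            { (inj₁ a≡v) → v∉A Aa a≡v
            ; (inj₂ (inj₁ Ba)) → disjoint Aa Ba
            ; (inj₂ (inj₂ (_ , a~v))) → a≁v a~v }
          where
          open Separation S
          closed : ∀ {u w} → u ∈D → w ∈D → w ≡ v ⊎ B w ⊎ A w × w ~ v → u ~ w → ¬ ¬ (u ≡ v ⊎ B u ⊎ A u × u ~ v)
          closed u∈D w∈D s e k with covered u∈D
          ... | inj₁ u≡v       = k (inj₁ u≡v)
          ... | inj₂ (inj₂ Bu) = k (inj₂ (inj₁ Bu))
          closed u∈D w∈D (inj₁ refl) e k | inj₂ (inj₁ Au) = k (inj₂ (inj₂ (Au , e)))
          closed u∈D w∈D (inj₂ (inj₁ Bw)) e k | inj₂ (inj₁ Au) = no-edge Au Bw e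
          closed u∈D w∈D (inj₂ (inj₂ (Aw , w~v))) e k | inj₂ (inj₁ Au) =
            not-mixed (_ , _ , Aw , Au , w~v , (λ u~v → k (inj₂ (inj₂ (Au , u~v)))) , E-sym e)

        -- Both sides turn out complete to `v`, so a vertex of `A` and one of `B` are nonadjacent
        -- and neither is a cut vertex of `D`.
        separation⇒atMostThree : ∀ {A B} → Separation v A B → ¬ ¬ AtMostThree
        separation⇒atMostThree {A} {B} S k = mixedA? λ completeA → mixedB? λ completeB →
          nonadjacent (A⊆D Aa) (B⊆D Bb) (λ { refl → disjoint Aa Bb }) (no-edge Aa Bb)
            (complete⇒noncut S completeA Aa) (complete⇒noncut (separation-sym S) completeB Bb) k
          where
          open Separation S
          Aa = proj₂ A-inhabited
          Bb = proj₂ B-inhabited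

          -- The induced path is `p x v b b′`, where `p` is a private neighbour of a vertex `x` on
          -- the complete side.
          one-mixed : ∀ {A B} → Separation v A B → (∀ {a} → A a → a ~ v) → ¬ Mixed B
          one-mixed S complete (b , b′ , Bb , Bb′ , b~v , b′≁v , b~b′) =
            private-neighbour (S.A⊆D Ax) v∈D v≢x (complete⇒noncut S complete Ax) λ (p , P) →
            let module P = Private P in
            P₅-free P.member (subset (S.A⊆D Ax)) (subset v∈D) (subset (S.B⊆D Bb)) (subset (S.B⊆D Bb′))
              P.edge (complete Ax) (E-sym b~v) b~b′
              (P.nonedge v∈D v≢x) (P.nonedge (S.B⊆D Bb) (λ { refl → S.disjoint Ax Bb }))
              (P.nonedge (S.B⊆D Bb′) (λ { refl → S.disjoint Ax Bb′ }))
              (S.no-edge Ax Bb) (S.no-edge Ax Bb′) (≁-sym b′≁v)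
            where
            module S = Separation S
            Ax = proj₂ S.A-inhabited
            v≢x = λ v≡x → S.v∉A Ax (sym v≡x)

          -- The induced path `a′ a v b b′` runs through `v` from one side to the other.
          both-mixed : Mixed A → ¬ Mixed B
          both-mixed (a , a′ , Aa , Aa′ , a~v , a′≁v , a~a′) (b , b′ , Bb , Bb′ , b~v , b′≁v , b~b′) =
            P₅-free (subset (A⊆D Aa′)) (subset (A⊆D Aa)) (subset v∈D) (subset (B⊆D Bb)) (subset (B⊆D Bb′))
              (E-sym a~a′) a~v (E-sym b~v) b~b′
              a′≁v (no-edge Aa′ Bb) (no-edge Aa′ Bb′) (no-edge Aa Bb) (no-edge Aa Bb′) (≁-sym b′≁v)

          mixedA? : ¬ ¬ (∀ {a} → A a → a ~ v)
          mixedA? h = h (complete-or-mixed S λ mixedA →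
            one-mixed (separation-sym S)
              (complete-or-mixed (separation-sym S) (both-mixed mixedA)) mixedA)

          mixedB? : ¬ ¬ (∀ {b} → B b → b ~ v)
          mixedB? h = mixedA? λ completeA → h (complete-or-mixed (separation-sym S) (one-mixed S completeA))

        cut-or-noncut : (∃₂ λ A B → Separation v A B) ⊎ ConnectedIn (delete v D)
        cut-or-noncut with any? (λ d → T? (delete v D d))
        ... | no none = inj₂ λ Q d∈ → ⊥-elim (none (_ , d∈))
        ... | yes (d , d∈)
            with any? (λ u → T? (delete v D u) ×-dec ¬? (T? (reach E (delete v D) d u)))
        ...   | no none = inj₂ (reach⇒connected d∈ λ u∈ → T-stable λ u∉R → none (_ , u∈ , u∉R))
        ...   | yes (u , u∈ , u∉R) =
          inj₁ ((λ w → T (delete v D w) × T (R w)) , (λ w → T (delete v D w) × ¬ T (R w)) , record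
            { A⊆D = λ (a∈ , _) → proj₁ (to (T-delete D) a∈)
            ; B⊆D = λ (b∈ , _) → proj₁ (to (T-delete D) b∈)
            ; v∉A = λ (a∈ , _) → proj₂ (to (T-delete D) a∈)
            ; v∉B = λ (b∈ , _) → proj₂ (to (T-delete D) b∈)
            ; disjoint = λ (_ , r) (_ , ¬r) → ¬r r
            ; covered = covered
            ; no-edge = λ (a∈ , r) (_ , ¬r) e → ¬r (reach-closed E (delete v D) d d∈ a∈ r (E-sym e))
            ; A-inhabited = d , d∈ , reach-root E (delete v D) d d∈
            ; B-inhabited = u , u∈ , u∉R })
          where
          R = reach E (delete v D) d

          covered : ∀ {w} → w ∈D →
            w ≡ v ⊎ T (delete v D w) × T (R w) ⊎ T (delete v D w) × ¬ T (R w)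
          covered {w} w∈D with w ≟ v | T? (R w)
          ... | yes w≡v | _      = inj₁ w≡v
          ... | no w≢v  | yes r  = inj₂ (inj₁ (from (T-delete D) (w∈D , w≢v) , r))
          ... | no w≢v  | no ¬r  = inj₂ (inj₂ (from (T-delete D) (w∈D , w≢v) , ¬r))

      -- A cut vertex of `D` already yields the second alternative. Without one, every vertex has a
      -- private neighbour as soon as `D` has another vertex, so a nonadjacent pair yields it too.
      clique-or-atMostThree : ¬ ¬ ((∀ {u w} → u ∈D → w ∈D → u ≢ w → u ~ w) ⊎ AtMostThree)
      clique-or-atMostThree k = k (inj₁ λ u∈D w∈D u≢w → T-stable λ u≁w →
        nonadjacent u∈D w∈D u≢w u≁w (noncut u∈D) (noncut w∈D) (k ∘ inj₂))
        where
        noncut : ∀ {v} → v ∈D → ConnectedIn (delete v D)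
        noncut v∈D with cut-or-noncut v∈D
        ... | inj₁ (_ , _ , S) = ⊥-elim (separation⇒atMostThree v∈D S (k ∘ inj₂))
        ... | inj₂ con         = con

-- Overlaying closed partial colourings

Unique : (Color → Bool) → Color → Set
Unique f c = T (f c) × (∀ d → T (f d) → d ≡ c)

opaque
  unique? : ∀ f → Dec (∃ (Unique f))
  unique? f = anyColor? λ c → T? (f c) ×-dec allColors? λ d → T? (f d) →-dec d ≟ᶜ c

  single : (Color → Bool) → Maybe Color
  single f with unique? f
  ... | yes (c , _) = just c
  ... | no _        = nothing

  single-just : ∀ f {c} → single f ≡ just c → Unique f c
  single-just f eq with unique? f
  single-just f refl | yes (_ , u) = u

  single-unique : ∀ f {c} → Unique f c → ∃ λ d → single f ≡ just d
  single-unique f u with unique? f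
  ... | yes (d , _) = d , refl
  ... | no ¬u       = ⊥-elim (¬u (_ , u))

third : ∀ b c d e → d ≢ c → b ≢ c → b ≢ d → e ≢ c → e ≢ d → e ≡ b
third = from-yes (allColors? λ b → allColors? λ c → allColors? λ d → allColors? λ e →
  ¬? (d ≟ᶜ c) →-dec ¬? (b ≟ᶜ c) →-dec ¬? (b ≟ᶜ d) →-dec ¬? (e ≟ᶜ c) →-dec ¬? (e ≟ᶜ d) →-dec e ≟ᶜ b)

-- One of three colours is absent, so a nonempty set that is no singleton contains both others.
single-nothing : ∀ f {b c d} → T (f b) → single f ≡ nothing → ¬ T (f c) → d ≢ c → T (f d)
single-nothing f {b} {c} {d} b∈f eq c∉f d≢c = T-stable λ d∉f →
  contradiction (trans (sym eq) (proj₂ (single-unique f (b∈f , λ e e∈f →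
    third b c d e d≢c (distinct b∈f c∉f) (distinct b∈f d∉f) (distinct e∈f c∉f) (distinct e∈f d∉f))))) λ ()
  where
  distinct : ∀ {a b} → T (f a) → ¬ T (f b) → a ≢ b
  distinct p q refl = q p

incompatible : ∀ c → ∃ λ d → ¬ T (compatible c d)
incompatible left  = right , id
incompatible right = left , id
incompatible cut   = cut , id

Proper : ∀ {n} → Rel n → (Fin n → Color) → Set
Proper E φ = ∀ u w → T (E u w) → T (compatible (φ u) (φ w))

module _ {n : ℕ} (E : Rel n) (E-sym : ∀ {u w} → T (E u w) → T (E w u)) where

  -- The analogue of an autarky for SAT: by the field `closed`, colours already given exclude
  -- nothing listed at uncoloured vertices of `P`, which can then be coloured as if the coloured
  -- ones were absent.
  record Closed (P : Fin n → Set) (M : Fin n → Color → Set) (σ : Fin n → Maybe Color) : Set where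
    field
      inside : ∀ {u c} → σ u ≡ just c → P u
      listed : ∀ {u c} → σ u ≡ just c → M u c
      proper : ∀ {u w c d} → T (E u w) → σ u ≡ just c → σ w ≡ just d → T (compatible c d)
      closed : ∀ {u w c d} → T (E u w) → σ u ≡ just c → σ w ≡ nothing → P w → M w d → T (compatible c d)

  overlay : (σ τ : Fin n → Maybe Color) → Fin n → Maybe Color
  overlay σ τ u = σ u <∣> τ u

  overlay-just : ∀ σ τ {u c} → overlay σ τ u ≡ just c → σ u ≡ just c ⊎ (σ u ≡ nothing × τ u ≡ just c)
  overlay-just σ τ {u} eq with σ u
  ... | just _  = inj₁ eq
  ... | nothing = inj₂ (refl , eq)

  overlay-nothing : ∀ σ τ {u} → overlay σ τ u ≡ nothing → σ u ≡ nothing × τ u ≡ nothing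
  overlay-nothing σ τ {u} eq with σ u
  ... | nothing = refl , eq

  -- On an edge between a vertex coloured by `σ` and one coloured only by `τ`, the `τ`-colour is
  -- listed, so closedness of `σ` makes the two compatible.
  overlay-closed : ∀ {P M σ τ} → Closed P M σ → Closed P M τ → Closed P M (overlay σ τ)
  overlay-closed {P} {M} {σ} {τ} S S′ = record
    { inside = λ p → [ S.inside , S′.inside ∘ proj₂ ]′ (overlay-just σ τ p)
    ; listed = λ p → [ S.listed , S′.listed ∘ proj₂ ]′ (overlay-just σ τ p)
    ; proper = λ e p q → both e (overlay-just σ τ p) (overlay-just σ τ q)
    ; closed = λ e p q → let q₁ , q₂ = overlay-nothing σ τ q in
        [ (λ p → S.closed e p q₁) , (λ (_ , p) → S′.closed e p q₂) ]′ (overlay-just σ τ p) }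
    where
    module S  = Closed S
    module S′ = Closed S′
    both : ∀ {u w c d} → T (E u w) → σ u ≡ just c ⊎ (σ u ≡ nothing × τ u ≡ just c) →
      σ w ≡ just d ⊎ (σ w ≡ nothing × τ w ≡ just d) → T (compatible c d)
    both e (inj₁ p)       (inj₁ q)       = S.proper e p q
    both e (inj₁ p)       (inj₂ (q , r)) = S.closed e p q (S′.inside r) (S′.listed r)
    both e (inj₂ (p , r)) (inj₁ q)       = compatible-sym (S.closed (E-sym e) q p (S′.inside r) (S′.listed r))
    both e (inj₂ (_ , p)) (inj₂ (_ , q)) = S′.proper e p q

  -- Used at two levels: inside a component, over the propagations started at its vertices, and in
  -- the whole graph, over the components.
  overlay-all : ∀ {P M} → (∀ u → Dec (P u)) →
    (∀ u → P u → ∃ λ σ → Closed P M σ × ∃ λ c → σ u ≡ just c) →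
    ∃ λ σ → Closed P M σ × ∀ u → P u → ∃ λ c → σ u ≡ just c
  overlay-all {P} {M} P? colour = let σ , S , total = go (allFin n) in σ , S , λ u → total u (∈-allFin u)
    where
    go : ∀ us → ∃ λ σ → Closed P M σ × ∀ u → u ∈ us → P u → ∃ λ c → σ u ≡ just c
    go [] = (λ _ → nothing) , record
      { inside = λ () ; listed = λ () ; proper = λ _ () ; closed = λ _ () } , λ _ ()
    go (v ∷ us) with P? v | go us
    ... | no v∉P | σ , S , total = σ , S , λ
          { _ (here refl) v∈P → contradiction v∈P v∉P ; u (there u∈) → total u u∈ }
    ... | yes v∈P | σ , S , total with colour v v∈P
    ...   | τ , S′ , c , τv = overlay τ σ , overlay-closed S′ S , λ
          { _ (here refl) _ → c , here′ τv ; u (there u∈) u∈P → there′ (total u u∈ u∈P) }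
      where
      here′ : ∀ {u c} → τ u ≡ just c → overlay τ σ u ≡ just c
      here′ {u} p rewrite p = refl
      there′ : ∀ {u} → (∃ λ c → σ u ≡ just c) → ∃ λ c → overlay τ σ u ≡ just c
      there′ {u} (c , p) with τ u
      ... | just d  = d , refl
      ... | nothing = c , p

-- Correctness of the polynomial-time part

solve : ∀ {n} → Lists n → VSet n → Rel n → Bool
solve L X E = eval solveᵉ (L ∷ X ∷ E ∷ [])

dominators : ∀ {n} → Rel n → VSet n → Fin n → VSet n
dominators E X r = minimize E (component E X r)

ends : ∀ {n} → Fin n → Fin n → Lists n → Lists n
ends a b L = assign right b (assign left a L)

TwoSat : ∀ {n} → Rel n → Lists n → Set
TwoSat E M = ∀ u → ∃ λ c → ∀ w → ∃ λ d → T (ac E (assign c u M) w d)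

twoSat : ∀ {n} → Lists n → Rel n → Bool
twoSat M E = eval twoSatᵉ (M ∷ E ∷ [])

opaque
  unfolding twoSatᵉ nonemptyᵉ

  T-twoSat : ∀ {n} (M : Lists n) E → T (twoSat M E) ⇔ TwoSat E M
  T-twoSat {n} M E = mk⇔
    (λ p u → let c , q = to (T-anyColor {ok u}) (to T-all p u) in
      c , λ w → to (T-anyColor {ac E (assign c u M) w}) (to T-all q w))
    (λ p → from T-all λ u → from (T-anyColor {ok u}) (proj₁ (p u) , from T-all λ w →
      from (T-anyColor {ac E (assign (proj₁ (p u)) u M) w}) (proj₂ (p u) w)))
    where
    ok : Fin n → Color → Bool
    ok u c = eval nonemptyᵉ (ac E (assign c u M) ∷ [])

record Guess {n} (E : Rel n) (L : Lists n) (D : VSet n) : Set where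
  constructor guessing
  field
    w v   : Fin n
    a b c : Color
    valid : TwoSat E (ac E (guess a b c L D v w))

extendable : ∀ {n} → Lists n → VSet n → Rel n → Bool
extendable L D E = eval extendableᵉ (L ∷ D ∷ E ∷ [])

opaque
  unfolding extendableᵉ

  T-extendable : ∀ {n} (L : Lists n) D E → T (extendable L D E) ⇔ Guess E L D
  T-extendable {n} L D E = mk⇔ to′ from′
    where
    ok : Fin n → Fin n → Color → Color → Color → Bool
    ok w v a b c = twoSat (ac E (guess a b c L D v w)) E

    okᵃ : Fin n → Fin n → Color → Bool
    okᵇ : Fin n → Fin n → Color → Color → Bool
    okᵃ w v a = ifᵇ okᵇ w v a left then true else (ifᵇ okᵇ w v a right then true else okᵇ w v a cut)
    okᵇ w v a b = ifᵇ ok w v a b left then true else (ifᵇ ok w v a b right then true else ok w v a b cut)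

    to′ : T (extendable L D E) → Guess E L D
    to′ p with to T-any p
    ... | w , q with to T-any q
    ...   | v , r with to (T-anyColor {okᵃ w v}) r
    ...     | a , s with to (T-anyColor {okᵇ w v a}) s
    ...       | b , t with to (T-anyColor {ok w v a b}) t
    ...         | c , o = guessing w v a b c (to (T-twoSat (ac E (guess a b c L D v w)) E) o)

    from′ : Guess E L D → T (extendable L D E)
    from′ (guessing w v a b c valid) =
      from T-any (w , from T-any (v ,
        from (T-anyColor {okᵃ w v}) (a , from (T-anyColor {okᵇ w v a}) (b ,
          from (T-anyColor {ok w v a b}) (c , from (T-twoSat (ac E (guess a b c L D v w)) E) valid)))))

opaque
  unfolding solveᵉ allExtendableᵉ

  T-solve : ∀ {n} (L : Lists n) X E →
    T (solve L X E) ⇔ ∃₂ λ a b → ∀ r → T (extendable (ends a b L) (dominators E X r) E)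
  T-solve L X E = mk⇔
    (λ p → let a , q = to T-any p ; b , r = to T-any q in a , b , to T-all r)
    (λ (a , b , p) → from T-any (a , from T-any (b , from T-all p)))

restrict : ∀ {n} → VSet n → (Fin n → Maybe Color) → Fin n → Maybe Color
restrict C σ u = ifᵇ C u then σ u else nothing

restrict-just : ∀ {n} (C : VSet n) σ {u c} → restrict C σ u ≡ just c → T (C u) × σ u ≡ just c
restrict-just C σ {u} eq with C u
... | true = tt , eq

restrict-∈ : ∀ {n} (C : VSet n) σ {u m} → T (C u) → restrict C σ u ≡ m → σ u ≡ m
restrict-∈ C σ {u} p eq with C u
... | true = eq

module _ {n : ℕ} (E : Rel n)
  (E-sym : ∀ {u w} → T (E u w) → T (E w u)) (E-irrefl : ∀ {u} → ¬ T (E u u)) where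

  module _ (X : VSet n) (r : Fin n) where

    private
      C D : VSet n
      C = component E X r
      D = dominators E X r

    component-closed : ∀ {u w} → ¬ T (X w) → T (C u) → T (E w u) → T (C w)
    component-closed {u} {w} w∉X u∈C e with to (T-component E X r) u∈C
    ... | r∉X , u∉X , reached = from (T-component E X r) (r∉X , w∉X ,
          reach-closed E (∁ X) r (from T-∁ r∉X) (from T-∁ u∉X) reached e)

    component-root : ¬ T (X r) → T (C r)
    component-root r∉X = from (T-component E X r) (r∉X , r∉X , reach-root E (∁ X) r (from T-∁ r∉X))

    component-⊆ : ∀ {u} → T (C u) → ¬ T (X u)
    component-⊆ u∈C = proj₁ (proj₂ (to (T-component E X r) u∈C))

    -- Paths through the complement of `X` from `r` never leave `C`, so `C` is connected by paths
    -- inside itself.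
    component-cds : ¬ T (X r) → T (cds E C C)
    component-cds r∉X = from (T-cds E C C) (r , r∈C , λ u u∈C → T-stable
      (reach-least E (∁ X) r r∈∁X (λ u → T (reach E C r u)) (reach-root E C r r∈C) closed
        (proj₂ (proj₂ (to (T-component E X r) u∈C)))))
      where
      r∈C : T (C r)
      r∈C = component-root r∉X

      r∈∁X : T (∁ X r)
      r∈∁X = from T-∁ r∉X

      closed : ∀ {u w} → T (∁ X w) → T (reach E C r w) → T (E u w) → T (reach E C r u)
      closed {u} {w} w∈∁X w∈R e = reach-closed E C r r∈C w∈C w∈R e
        where
        w∈C : T (C w)
        w∈C = from (T-component E X r) (r∉X , to T-∁ w∈∁X ,
          reach-mono E C (∁ X) r r∈C (λ u u∈C → from T-∁ (component-⊆ u∈C)) w w∈R)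

    dominators-cds : ¬ T (X r) → T (cds E D C)
    dominators-cds r∉X = Minimal.cds-valid (minimize-minimal E C) (component-cds r∉X)

    dominators-dominating : ∀ {u} → T (C u) → ¬ ¬ (T (D u) ⊎ ∃ λ w → T (D w) × T (E u w))
    dominators-dominating u∈C = D-dominating E E-sym E-irrefl C D (minimize-minimal E C)
      (dominators-cds (proj₁ (to (T-component E X r) u∈C))) u∈C

  module _ (L : Lists n) (X : VSet n)
    (fixed : ∀ {x} → T (X x) → ∃ λ c → ∀ {d} → T (L x d) → d ≡ c) where

    -- Compatibility with the fixed colours on `X` is all that the colouring of one component may
    -- demand of the vertices outside it.
    Supportable : Fin n → Color → Set
    Supportable u d = T (L u d) × ∀ {x} → T (X x) → T (E u x) → ∃ λ e → T (compatible d e) × T (L x e)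

    module _ (r : Fin n) (G : Guess E L (dominators E X r)) where

      private
        open module G = Guess G

        C D : VSet n
        C = component E X r
        D = dominators E X r

        M : Lists n
        M = ac E (guess a b c L D v w)

        M-consistent : Consistent E (Members M)
        M-consistent = ac-consistent E (guess a b c L D v w)

        M⊆guess : Members M ⊆ˡ guess a b c L D v w
        M⊆guess = ac-⊆ E (guess a b c L D v w)

        M⊆L : Members M ⊆ˡ L
        M⊆L u d p = guess-⊆ a b c L D v w u d (M⊆guess u d p)

        -- Domination by D is what brings every list down to two colours.
        missing : ∀ {u} → T (C u) → ∃ λ c → ¬ T (M u c)
        missing {u} u∈C = decidable-stable (anyColor? λ c → ¬? (T? (M u c))) λ full →
          dominators-dominating X r u∈C λ
            { (inj₁ u∈D) → let e , only = guess-unique a b c L D v w u∈D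
                               d , d≢e  = another e
                           in full (d , λ d∈M → d≢e (only (M⊆guess u d d∈M)))
            ; (inj₂ (z , z∈D , e)) → let f , only = guess-unique a b c L D v w z∈D
                                         d , f≁d  = incompatible f
                                     in full (d , λ d∈M → let g , d~g , g∈M = M-consistent u d d∈M z e
                                       in f≁d (compatible-sym {d} {f} (subst (T ∘ compatible d) (only (M⊆guess z g g∈M)) d~g))) }
          where
          another : ∀ e → ∃ λ d → d ≢ e
          another left  = right , λ ()
          another right = left , λ ()
          another cut   = left , λ ()

        module _ (z : Fin n) where

          K : Lists n
          K = ac E (assign (proj₁ (valid z)) z M)

          K-consistent : Consistent E (Members K)
          K-consistent = ac-consistent E (assign (proj₁ (valid z)) z M)

          K⊆M : Members K ⊆ˡ M
          K⊆M u d p = proj₁ (to (T-assign (proj₁ (valid z)) z M) (ac-⊆ E (assign (proj₁ (valid z)) z M) u d p))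

          K-inhabited : ∀ u → ∃ λ d → T (K u d)
          K-inhabited = proj₂ (valid z)

          K-assigned : ∀ {d} → T (K z d) → d ≡ proj₁ (valid z)
          K-assigned {d} p = proj₂ (to (T-assign (proj₁ (valid z)) z M) (ac-⊆ E (assign (proj₁ (valid z)) z M) z d p)) refl

          σ : Fin n → Maybe Color
          σ = restrict C (λ u → single (K u))

          σ-unique : ∀ {u d} → σ u ≡ just d → T (C u) × Unique (K u) d
          σ-unique {u} eq with restrict-just C (λ u → single (K u)) {u} eq
          ... | p , q = p , single-just (K u) q

          σ-closed : Closed E E-sym (T ∘ C) (Members M) σ
          σ-closed = record
            { inside = λ {u} p → proj₁ (σ-unique {u} p)
            ; listed = λ {u} {d} p → K⊆M u d (proj₁ (proj₂ (σ-unique {u} p)))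
            ; proper = proper
            ; closed = closed }
            where
            proper : ∀ {u w c d} → T (E u w) → σ u ≡ just c → σ w ≡ just d → T (compatible c d)
            proper {u} {w} {c} e p q
              with σ-unique {u} p | σ-unique {w} q
            ... | _ , c∈K , _ | _ , _ , only with K-consistent u c c∈K w e
            ...   | d , c~d , d∈K = subst (T ∘ compatible c) (only d d∈K) c~d

            closed : ∀ {u w c d} → T (E u w) → σ u ≡ just c → σ w ≡ nothing → T (C w) → T (M w d) →
              T (compatible c d)
            closed {u} {w} {c} {d} e p q w∈C d∈M =
              agree (σ-unique {u} p) (K-consistent w d d∈K u (E-sym e))
              where
              -- The list of `w` in `M` lacks a colour, while its sublist in `K` is neither empty
              -- nor a singleton; hence the two coincide.
              d∈K : T (K w d)
              d∈K = single-nothing (K w) (proj₂ (K-inhabited w))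
                (restrict-∈ C (λ u → single (K u)) {w} w∈C q)
                (proj₂ (missing w∈C) ∘ K⊆M w _) (λ { refl → proj₂ (missing w∈C) d∈M })

              agree : T (C u) × Unique (K u) c → (∃ λ c′ → T (compatible d c′) × T (K u c′)) →
                T (compatible c d)
              agree (_ , _ , only) (c′ , d~c′ , c′∈K) =
                compatible-sym {d} {c} (subst (T ∘ compatible d) (only c′ c′∈K) d~c′)

        -- The propagation started at `z` colours at least `z`, so overlaying one for each vertex of
        -- `C` colours all of `C`.
        component-colouring : ∃ λ τ → Closed E E-sym (T ∘ C) (Members M) τ × ∀ u → T (C u) → ∃ λ d → τ u ≡ just d
        component-colouring = overlay-all E E-sym (λ u → T? (C u)) λ z z∈C →
          σ z , σ-closed z , extend z z∈C
          where
          extend : ∀ z → T (C z) → ∃ λ d → σ z z ≡ just d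
          extend z z∈C with C z
          ... | true = single-unique (K z z) (proj₂ (K-inhabited z z) , λ d d∈K →
                trans (K-assigned z d∈K) (sym (K-assigned z (proj₂ (K-inhabited z z)))))

        τ : Fin n → Maybe Color
        τ = proj₁ component-colouring

        module τ = Closed (proj₁ (proj₂ component-colouring))

        -- Lists on `X` admit at most one colour, so the inhabitant found by the propagation at `r`
        -- is that colour.
        ρ : Fin n → Maybe Color
        ρ u = ifᵇ X u then just (proj₁ (K-inhabited r u)) else τ u

        ρ-cases : ∀ {u d} → ρ u ≡ just d → T (M u d) × (T (X u) ⊎ τ u ≡ just d)
        ρ-cases {u} eq with X u
        ρ-cases {u} refl | true  = K⊆M r u _ (proj₂ (K-inhabited r u)) , inj₁ tt
        ρ-cases {u} eq   | false = τ.listed eq , inj₂ eq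

        ρ-nothing : ∀ {u} → ρ u ≡ nothing → ¬ T (X u) × ¬ T (C u)
        ρ-nothing {u} eq with X u
        ... | false = id , λ u∈C → contradiction (trans (sym eq) (proj₂ (proj₂ (proj₂ component-colouring) u u∈C))) λ ()

      -- No edge leads from `C` to a vertex outside `C` and `X`. An uncoloured vertex is therefore
      -- constrained by `X` alone, and `Supportable` has taken that into account.
      component-closed-colouring : ∃ λ ρ → Closed E E-sym (λ _ → ⊤) Supportable ρ × ∃ λ d → ρ r ≡ just d
      component-closed-colouring = ρ , record
        { inside = λ _ → tt
        ; listed = λ {u} p → listed (proj₁ (ρ-cases {u} p))
        ; proper = proper
        ; closed = closed } , root
        where
        listed : ∀ {u d} → T (M u d) → Supportable u d
        listed {u} {d} p = M⊆L u d p , λ {x} _ e →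
          let f , d~f , f∈M = M-consistent u d p x e in f , d~f , M⊆L x f f∈M

        same : ∀ {x d e} → T (X x) → T (L x d) → T (L x e) → d ≡ e
        same x∈X p q = let _ , only = fixed x∈X in trans (only p) (sym (only q))

        to-X : ∀ {u w c d} → T (X w) → T (E u w) → T (M u c) → T (M w d) → T (compatible c d)
        to-X {u} {w} {c} {d} w∈X e p q with M-consistent u c p w e
        ... | f , c~f , f∈M = subst (T ∘ compatible c) (same w∈X (M⊆L w f f∈M) (M⊆L w d q)) c~f

        proper : ∀ {u w c d} → T (E u w) → ρ u ≡ just c → ρ w ≡ just d → T (compatible c d)
        proper {u} {w} {c} {d} e p q with ρ-cases {u} p | ρ-cases {w} q
        ... | c∈M , inj₁ u∈X | d∈M , _        = compatible-sym {d} {c} (to-X u∈X (E-sym e) d∈M c∈M)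
        ... | c∈M , inj₂ _   | d∈M , inj₁ w∈X = to-X w∈X e c∈M d∈M
        ... | _   , inj₂ p′  | _   , inj₂ q′  = τ.proper e p′ q′

        closed : ∀ {u w c d} → T (E u w) → ρ u ≡ just c → ρ w ≡ nothing → ⊤ → Supportable w d →
          T (compatible c d)
        closed {u} {w} {c} {d} e p q _ (_ , supported) with ρ-cases {u} p | ρ-nothing {w} q
        ... | c∈M , inj₁ u∈X | _ with supported u∈X (E-sym e)
        ...   | f , d~f , f∈L = compatible-sym {d} {c} (subst (T ∘ compatible d) (same u∈X f∈L (M⊆L u c c∈M)) d~f)
        closed {u} {w} {c} {d} e p q _ _ | _ , inj₂ p′ | w∉X , w∉C =
          contradiction (component-closed X r w∉X (τ.inside p′) (E-sym e)) w∉C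

        root : ∃ λ d → ρ r ≡ just d
        root with ρ r in eq
        ... | just d  = d , refl
        ... | nothing = let r∉X , r∉C = ρ-nothing {r} eq in contradiction (component-root X r r∉X) r∉C

    guesses⇒colouring : (∀ r → Guess E L (dominators E X r)) →
      ∃ λ φ → Proper E φ × ∀ u → T (L u (φ u))
    guesses⇒colouring G = φ , (λ u w e → S.proper e (φ-just u) (φ-just w)) , λ u → proj₁ (S.listed (φ-just u))
      where
      combined : ∃ λ σ → Closed E E-sym (λ _ → ⊤) Supportable σ × ∀ u → ⊤ → ∃ λ c → σ u ≡ just c
      combined = overlay-all E E-sym (λ _ → yes tt) λ r _ → component-closed-colouring r (G r)

      module S = Closed (proj₁ (proj₂ combined))

      φ : Fin n → Color
      φ u = proj₁ (proj₂ (proj₂ combined) u tt)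

      φ-just : ∀ u → proj₁ combined u ≡ just (φ u)
      φ-just u = proj₂ (proj₂ (proj₂ combined) u tt)

  T-ends : ∀ a b (L : Lists n) {u d} → T (ends a b L u d) ⇔ (T (L u d) × (u ≡ a → d ≡ left) × (u ≡ b → d ≡ right))
  T-ends a b L {u} {d} = mk⇔
    (λ p → let q , r = to (T-assign right b (assign left a L)) p
               s , t = to (T-assign left a L) q in s , t , r)
    (λ (s , t , r) → from (T-assign right b (assign left a L)) (from (T-assign left a L) (s , t) , r))

  solve-sound : ∀ L X → (∀ {x} → T (X x) → ∃ λ c → ∀ {d} → T (L x d) → d ≡ c) → T (solve L X E) →
    ∃ λ φ → Proper E φ × (∃ λ a → φ a ≡ left) × (∃ λ b → φ b ≡ right)
  solve-sound L X fixed p with to (T-solve L X E) p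
  ... | a , b , q with guesses⇒colouring (ends a b L) X
          (λ x∈X → let c , only = fixed x∈X in c , λ d∈ → only (proj₁ (to (T-ends a b L) d∈)))
          (λ r → to (T-extendable (ends a b L) (dominators E X r) E) (q r))
  ...   | φ , proper , listed = φ , proper
          , (a , proj₁ (proj₂ (to (T-ends a b L) (listed a))) refl)
          , (b , proj₂ (proj₂ (to (T-ends a b L) (listed b))) refl)

  module _ {φ : Fin n → Color} (φ-proper : Proper E φ) where

    private
      Φ : Fin n → Color → Set
      Φ u c = φ u ≡ c

      Φ-consistent : Consistent E Φ
      Φ-consistent u _ refl w e = φ w , φ-proper u w e , refl

    equal-off-cut : ∀ {u w} → T (E u w) → φ u ≢ cut → φ w ≢ cut → φ u ≡ φ w
    equal-off-cut {u} {w} e p q = noncut (φ u) (φ w) (φ-proper u w e) p q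
      where
      noncut : ∀ c d → T (compatible c d) → c ≢ cut → d ≢ cut → c ≡ d
      noncut left  left  _ _ _ = refl
      noncut right right _ _ _ = refl
      noncut left  cut   _ _ q = ⊥-elim (q refl)
      noncut right cut   _ _ q = ⊥-elim (q refl)
      noncut cut   left  _ p _ = ⊥-elim (p refl)
      noncut cut   right _ p _ = ⊥-elim (p refl)

    cut-neighbour : ∀ {u s} → T (E u s) → φ s ≡ cut → φ u ≢ cut
    cut-neighbour {u} {s} e p q with φ u | φ s | φ-proper u s e
    cut-neighbour e refl refl | _ | _ | ()

    AlmostConstant : VSet n → Set
    AlmostConstant D = ∃ λ v → ∃₂ λ w c → ∀ u → T (D u) → u ≡ v ⊎ u ≡ w ⊎ φ u ≡ c

    clique⇒almostConstant : ∀ {D} → Fin n → (∀ {u w} → T (D u) → T (D w) → u ≢ w → T (E u w)) → AlmostConstant D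
    clique⇒almostConstant {D} r clique with any? (λ s → T? (D s) ×-dec (φ s ≟ᶜ cut))
    ... | yes (s , s∈D , s-cut) with any? (λ t → T? (D t) ×-dec ¬? (t ≟ s))
    -- `s` is the only cut vertex of the clique; all others are off the cut and equal or adjacent to
    -- `t`, hence on its side.
    ...   | yes (t , t∈D , t≢s) = s , t , φ t , λ u u∈D → case u u∈D
      where
      case : ∀ u → T (D u) → u ≡ s ⊎ u ≡ t ⊎ φ u ≡ φ t
      case u u∈D with u ≟ s | u ≟ t
      ... | yes p | _     = inj₁ p
      ... | no _  | yes q = inj₂ (inj₁ q)
      ... | no p  | no q  = inj₂ (inj₂ (equal-off-cut (clique u∈D t∈D q)
            (cut-neighbour (clique u∈D s∈D p) s-cut) (cut-neighbour (clique t∈D s∈D t≢s) s-cut)))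
    ...   | no none = s , s , cut , λ u u∈D → inj₁ (decidable-stable (u ≟ s) λ u≢s → none (u , u∈D , u≢s))
    clique⇒almostConstant {D} r clique | no no-cut with any? (λ t → T? (D t))
    -- With `D` empty, `r` merely supplies vertices for the existentials.
    ...   | no empty = r , r , cut , λ u u∈D → contradiction (u , u∈D) empty
    ...   | yes (t , t∈D) = t , t , φ t , λ u u∈D → case u u∈D
      where
      case : ∀ u → T (D u) → u ≡ t ⊎ u ≡ t ⊎ φ u ≡ φ t
      case u u∈D with u ≟ t
      ... | yes p = inj₁ p
      ... | no p  = inj₂ (inj₂ (equal-off-cut (clique u∈D t∈D p)
            (λ q → no-cut (u , u∈D , q)) (λ q → no-cut (t , t∈D , q))))

    twoSat-complete : ∀ M → (∀ u → T (M u (φ u))) → TwoSat E M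
    twoSat-complete M φ∈M u = φ u , λ w → φ w ,
      ac-greatest E (assign (φ u) u M) Φ-consistent
        (λ z _ → λ { refl → from (T-assign (φ u) u M) (φ∈M z , cong φ) }) w (φ w) refl

    extendable-complete : ∀ L D → AlmostConstant D → (∀ u → T (L u (φ u))) → T (extendable L D E)
    extendable-complete L D (v , w , c , p) φ∈L = from (T-extendable L D E)
      (guessing w v (φ v) (φ w) c (twoSat-complete (ac E (guess (φ v) (φ w) c L D v w)) λ u →
        ac-greatest E (guess (φ v) (φ w) c L D v w) Φ-consistent
          (λ z _ → λ { refl → guess-intro φ L D v w c φ∈L p z }) u (φ u) refl))

    dominators-almostConstant : ∀ X → NoInducedP₅ E E-sym E-irrefl (∁ X) → ∀ r → ¬ ¬ AlmostConstant (dominators E X r)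
    dominators-almostConstant X P₅-free r k with T? (X r)
    ... | yes r∈X = k (r , r , cut , λ u u∈D →
          contradiction r∈X (proj₁ (to (T-component E X r) (Minimal.subset (minimize-minimal E (component E X r)) u∈D))))
    ... | no r∉X = clique-or-atMostThree E E-sym E-irrefl C (dominators E X r) (minimize-minimal E C)
          (dominators-cds X r r∉X) P₅-free-C λ
            { (inj₁ clique) → k (clique⇒almostConstant r clique)
            ; (inj₂ (x , y , m , cover)) → k (x , y , φ m , λ u u∈D →
                [ inj₁ , [ inj₂ ∘ inj₁ , inj₂ ∘ inj₂ ∘ cong φ ]′ ]′ (cover u∈D)) }
      where
      C : VSet n
      C = component E X r

      in-∁X : ∀ {u} → T (C u) → T (∁ X u)
      in-∁X u∈C = from T-∁ (component-⊆ X r u∈C)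

      P₅-free-C : NoInducedP₅ E E-sym E-irrefl C
      P₅-free-C a b c d e = P₅-free (in-∁X a) (in-∁X b) (in-∁X c) (in-∁X d) (in-∁X e)

    solve-complete : ∀ L X → NoInducedP₅ E E-sym E-irrefl (∁ X) → (∀ u → T (L u (φ u))) →
      ∀ {a b} → φ a ≡ left → φ b ≡ right → T (solve L X E)
    solve-complete L X P₅-free φ∈L {a} {b} φa φb = from (T-solve L X E) (a , b , λ r → T-stable λ k →
      dominators-almostConstant X P₅-free r λ almost →
      k (extendable-complete (ends a b L) (dominators E X r) almost λ u →
        from (T-ends a b L) (φ∈L u , (λ { refl → φa }) , (λ { refl → φb }))))

-- Enumerating the colourings of a vertex set

CSet : Set
CSet = Color → Bool

full : CSet
full _ = true

only : Color → CSet
only c d = d == c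

grow : Bool → List (List CSet) → List CSet → List (List CSet)
grow true  Ls l = (only left ∷ l) ∷ (only right ∷ l) ∷ (only cut ∷ l) ∷ Ls
grow false Ls l = (full ∷ l) ∷ Ls

extend : List (List CSet) → Bool → List (List CSet)
extend Ls b = foldl (grow b) [] Ls

colourings : List Bool → List (List CSet)
colourings = foldr (flip extend) ([] ∷ [])

Grown : Bool → List CSet → List CSet → Set
Grown b l l′ = ∃ λ c → l′ ≡ (ifᵇ b then only c else full) ∷ l

extend⁻ : ∀ b acc Ls {l′} → l′ ∈ foldl (grow b) acc Ls → l′ ∈ acc ⊎ ∃ λ l → l ∈ Ls × Grown b l l′
extend⁻ b acc [] p = inj₁ p
extend⁻ b acc (l ∷ Ls) p with extend⁻ b (grow b acc l) Ls p
... | inj₂ (k , k∈ , g) = inj₂ (k , there k∈ , g)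
... | inj₁ q            = new b q
  where
  new : ∀ b {l′} → l′ ∈ grow b acc l → l′ ∈ acc ⊎ ∃ λ k → k ∈ (l ∷ Ls) × Grown b k l′
  new true  (here eq)                 = inj₂ (l , here refl , left , eq)
  new true  (there (here eq))         = inj₂ (l , here refl , right , eq)
  new true  (there (there (here eq))) = inj₂ (l , here refl , cut , eq)
  new true  (there (there (there q))) = inj₁ q
  -- Off `X` the entry is `full` whatever the witness; `left` is a placeholder.
  new false (here eq)                 = inj₂ (l , here refl , left , eq)
  new false (there q)                 = inj₁ q

extend⁺-acc : ∀ b acc Ls {l′} → l′ ∈ acc → l′ ∈ foldl (grow b) acc Ls
extend⁺-acc b acc []       p = p
extend⁺-acc b acc (l ∷ Ls) p = extend⁺-acc b (grow b acc l) Ls (old b p)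
  where
  old : ∀ b {l′} → l′ ∈ acc → l′ ∈ grow b acc l
  old true  q = there (there (there q))
  old false q = there q

extend⁺ : ∀ b acc Ls {l l′} → l ∈ Ls → Grown b l l′ → l′ ∈ foldl (grow b) acc Ls
extend⁺ b acc (l ∷ Ls) (there p)   g = extend⁺ b (grow b acc l) Ls p g
extend⁺ b acc (l ∷ Ls) (here refl) g = extend⁺-acc b (grow b acc l) Ls (new b g)
  where
  new : ∀ b {l′} → Grown b l l′ → l′ ∈ grow b acc l
  new true  (left  , eq) = here eq
  new true  (right , eq) = there (here eq)
  new true  (cut   , eq) = there (there (here eq))
  new false (_     , eq) = here eq

branching : Bool → ℕ
branching b = ifᵇ b then 3 else 1

length-extend : ∀ b acc Ls → length (foldl (grow b) acc Ls) ≡ length Ls * branching b + length acc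
length-extend b acc [] = refl
length-extend b acc (l ∷ Ls) = begin
  length (foldl (grow b) (grow b acc l) Ls)             ≡⟨ length-extend b (grow b acc l) Ls ⟩
  length Ls * branching b + length (grow b acc l)       ≡⟨ cong (length Ls * branching b +_) (length-grow b) ⟩
  length Ls * branching b + (branching b + length acc)  ≡⟨ +-assoc (length Ls * branching b) _ _ ⟨
  length Ls * branching b + branching b + length acc    ≡⟨ cong (_+ length acc) (+-comm (length Ls * branching b) _) ⟩
  length (l ∷ Ls) * branching b + length acc            ∎
  where
  open ≡-Reasoning
  length-grow : ∀ b → length (grow b acc l) ≡ branching b + length acc
  length-grow true  = refl
  length-grow false = refl

#colourings : List Bool → ℕ
#colourings bs = product (map branching bs)

length-colourings : ∀ bs → length (colourings bs) ≡ #colourings bs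
length-colourings []       = refl
length-colourings (b ∷ bs) = begin
  length (extend (colourings bs) b)            ≡⟨ length-extend b [] (colourings bs) ⟩
  length (colourings bs) * branching b + 0     ≡⟨ +-identityʳ _ ⟩
  length (colourings bs) * branching b         ≡⟨ *-comm _ (branching b) ⟩
  branching b * length (colourings bs)         ≡⟨ cong (branching b *_) (length-colourings bs) ⟩
  #colourings (b ∷ bs)                         ∎
  where open ≡-Reasoning

#colourings-toList : ∀ {n} (X : Subset n) → #colourings (toList X) ≡ 3 ^ ∣ X ∣
#colourings-toList []          = refl
#colourings-toList (true ∷ X)  = cong (3 *_) (#colourings-toList X)
#colourings-toList (false ∷ X) = trans (+-identityʳ _) (#colourings-toList X)

-- Beyond the end of the list, the value is irrelevant.
nth : List CSet → ℕ → CSet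
nth []      _       = full
nth (f ∷ l) zero    = f
nth (f ∷ l) (suc i) = nth l i

decode : ∀ {n} → List CSet → Lists n
decode l i = nth l (toℕ i)

colourings-length : ∀ {n} (X : Vec Bool n) {l} → l ∈ colourings (toList X) → length l ≡ n
colourings-length []      (here refl) = refl
colourings-length (b ∷ X) p with extend⁻ b [] (colourings (toList X)) p
... | inj₂ (l , l∈ , _ , refl) = cong suc (colourings-length X l∈)

colourings-fixed : ∀ {n} (X : Vec Bool n) {l} → l ∈ colourings (toList X) →
  ∀ i → T (lookup X i) → ∃ λ c → decode l i ≡ only c
colourings-fixed (b ∷ X) p i i∈X with extend⁻ b [] (colourings (toList X)) p
colourings-fixed (true ∷ X) p zero    i∈X | inj₂ (l , l∈ , c , refl) = c , refl
colourings-fixed (b ∷ X)    p (suc i) i∈X | inj₂ (l , l∈ , c , refl) = colourings-fixed X l∈ i i∈X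

colourings-complete : ∀ {n} (X : Vec Bool n) (φ : Fin n → Color) →
  ∃ λ l → l ∈ colourings (toList X) × ∀ i → T (decode l i (φ i))
colourings-complete []      φ = [] , here refl , λ ()
colourings-complete (b ∷ X) φ with colourings-complete X (φ ∘ suc)
... | l , l∈ , φ∈ = _ , extend⁺ b [] (colourings (toList X)) l∈ (φ zero , refl) , λ
      { zero → listed b ; (suc i) → φ∈ i }
  where
  listed : ∀ b → T ((ifᵇ b then only (φ zero) else full) (φ zero))
  listed true  = from (T-== {φ zero}) refl
  listed false = tt

-- A colour set contains no row, so its encoding is the same for every number of vertices; 0 is an
-- arbitrary choice.
encodeCSet : CSet → Tree
encodeCSet = encode (cols bool) {0}

encodeList-tabulate : ∀ {A B : Set} {n} (enc : B → Tree) (g : A → B) (f : Fin n → A) →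
  encodeList (λ a → enc (g a)) (tabulate f) ≡ encodeList enc (tabulate (g ∘ f))
encodeList-tabulate {n = zero}  enc g f = refl
encodeList-tabulate {n = suc n} enc g f = cong (node _) (encodeList-tabulate enc g (f ∘ suc))

tabulate-lookup : ∀ {n} {A : Set} (xs : Vec A n) → tabulate (lookup xs) ≡ toList xs
tabulate-lookup []       = refl
tabulate-lookup (x ∷ xs) = cong (x ∷_) (tabulate-lookup xs)

tabulate-nth : ∀ n l → length l ≡ n → tabulate {n = n} (decode l) ≡ l
tabulate-nth zero    []      refl = refl
tabulate-nth (suc n) (f ∷ l) eq   = cong (f ∷_) (tabulate-nth n l (suc-injective eq))

encode-subset : ∀ {n} (X : Subset n) → encode vset (lookup X) ≡ encodeSubset X
encode-subset X = trans (encodeList-tabulate encodeBool (lookup X) id)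
  (cong (encodeList encodeBool) (tabulate-lookup X))

encode-decode : ∀ {n} l → length l ≡ n → encode lists {n} (decode l) ≡ encodeList encodeCSet l
encode-decode {n} l eq = trans (encodeList-tabulate {n = n} encodeCSet (decode l) id)
  (cong (encodeList encodeCSet) (tabulate-nth n l eq))

-- The exponential-time part

constᵖ : Tree → Program
constᵖ nil        = null
constᵖ (node a b) = ⟨ constᵖ a , constᵖ b ⟩

constʷ : ∀ y {x} → constᵖ y ⊢ x ⇓ y within size y
constʷ nil        = nullʷ
constʷ (node a b) = ⟨ constʷ a , constʷ b ⟩ʷ

encodeCSets : List (List CSet) → Tree
encodeCSets = encodeList (encodeList encodeCSet)

prependᵖ : CSet → Program → Program
prependᵖ f p = ⟨ ⟨ constᵖ (encodeCSet f) , hd ⨾ hd ⟩ , p ⟩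

growᵖ : Program
growᵖ = ⟨ tl ⨾ hd , if tl ⨾ hd
  then prependᵖ (only left) (prependᵖ (only right) (prependᵖ (only cut) (tl ⨾ tl)))
  else prependᵖ full (tl ⨾ tl) ⟩

-- The cost of the branch with three new lists, each prepended in 12 steps, of which 7 write the
-- colour set. The other branch takes 27.
growCost : ℕ
growCost = 47

prependʷ : ∀ f l Ls {p rest s b} →
  p ⊢ node (node (encodeList encodeCSet l) rest) s ⇓ encodeCSets Ls within b →
  prependᵖ f p ⊢ node (node (encodeList encodeCSet l) rest) s ⇓ encodeCSets ((f ∷ l) ∷ Ls)
    within suc (suc (size (encodeCSet f) + 3) + b)
prependʷ f l Ls P = ⟨ ⟨ constʷ (encodeCSet f) , hdʷ ⨾ʷ hdʷ ⟩ʷ , P ⟩ʷ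

growʷ : ∀ b l Ls {rest} →
  growᵖ ⊢ node (node (encodeList encodeCSet l) rest) (node (encodeBool b) (encodeCSets Ls))
    ⇓ node (encodeBool b) (encodeCSets (grow b Ls l)) within growCost
growʷ true l Ls = ⟨ tlʷ ⨾ʷ hdʷ , thenʷ (tlʷ ⨾ʷ hdʷ)
  (prependʷ (only left) l ((only right ∷ l) ∷ (only cut ∷ l) ∷ Ls)
    (prependʷ (only right) l ((only cut ∷ l) ∷ Ls)
      (prependʷ (only cut) l Ls (tlʷ ⨾ʷ tlʷ)))) ⟩ʷ
growʷ false l Ls = weaken-within (m≤m+n 27 20)
  ⟨ tlʷ ⨾ʷ hdʷ , elseʷ (tlʷ ⨾ʷ hdʷ) (prependʷ full l Ls (tlʷ ⨾ʷ tlʷ)) ⟩ʷ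

extendᵖ : Program
extendᵖ = ⟨ tl , ⟨ hd ⨾ hd , null ⟩ ⟩ ⨾ consume growᵖ ⨾ tl ⨾ tl

extendCost : ℕ → ℕ
extendCost m = suc (7 + suc (loopCost m growCost + 3))

extendʷ : ∀ b {rest} Ls →
  extendᵖ ⊢ node (node (encodeBool b) rest) (encodeCSets Ls) ⇓ encodeCSets (extend Ls b)
    within extendCost (length Ls)
extendʷ b Ls = ⟨ tlʷ , ⟨ hdʷ ⨾ʷ hdʷ , nullʷ ⟩ʷ ⟩ʷ ⨾ʷ
  consume-foldl (encodeList encodeCSet) (λ Ls → node (encodeBool b) (encodeCSets Ls)) (grow b)
    (λ _ _ → ⊤) (λ l ls Ls _ → tt , growʷ b l Ls) Ls [] tt ⨾ʷ
  tlʷ ⨾ʷ tlʷ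

reverseᵖ : Program
reverseᵖ = ⟨ hd , null ⟩ ⨾ consume ⟨ hd ⨾ hd , tl ⟩ ⨾ tl

reverseCost lengthCost : ℕ → ℕ
reverseCost n = suc (3 + suc (loopCost n 5 + 1))
lengthCost n = suc (3 + suc (loopCost n 3 + 1))

reverseʷ : ∀ {A : Set} (enc : A → Tree) xs {y} →
  reverseᵖ ⊢ node (encodeList enc xs) y ⇓ encodeList enc (reverse xs) within reverseCost (length xs)
reverseʷ enc xs = ⟨ hdʷ , nullʷ ⟩ʷ ⨾ʷ
  consume-foldl enc (encodeList enc) (flip _∷_) (λ _ _ → ⊤)
    (λ _ _ _ _ → tt , ⟨ hdʷ ⨾ʷ hdʷ , tlʷ ⟩ʷ) xs [] tt ⨾ʷ tlʷ

lengthᵖ : Program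
lengthᵖ = ⟨ tl , null ⟩ ⨾ consume ⟨ null , tl ⟩ ⨾ tl

lengthʷ : ∀ {A : Set} (enc : A → Tree) xs {y} →
  lengthᵖ ⊢ node y (encodeList enc xs) ⇓ encodeℕ (length xs) within lengthCost (length xs)
lengthʷ enc xs {y} =
  subst (λ m → lengthᵖ ⊢ node y (encodeList enc xs) ⇓ encodeℕ m within lengthCost (length xs)) (count 0 xs)
  (⟨ tlʷ , nullʷ ⟩ʷ ⨾ʷ
  consume-foldl enc encodeℕ (λ m _ → suc m) (λ _ _ → ⊤)
    (λ _ _ _ _ → tt , ⟨ nullʷ , tlʷ ⟩ʷ) xs 0 tt ⨾ʷ tlʷ)
  where
  count : ∀ {A : Set} m (xs : List A) → foldl (λ m _ → suc m) m xs ≡ m + length xs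
  count m []       = sym (+-identityʳ m)
  count m (x ∷ xs) = trans (count (suc m) xs) (sym (+-suc m (length xs)))

-- `colourings` is a right fold, whereas a loop consumes its list from the front; hence the
-- reversal.
colouringsᵖ : Program
colouringsᵖ = ⟨ reverseᵖ , constᵖ (encodeCSets ([] ∷ [])) ⟩ ⨾ consume extendᵖ ⨾ tl

colouringsCost : ℕ → ℕ → ℕ
colouringsCost m n = suc (suc (reverseCost n + 3) + suc (loopCost n (extendCost m) + 1))

colouringsʷ : ∀ {n} (X : Subset n) {y} →
  colouringsᵖ ⊢ node (encodeSubset X) y ⇓ encodeCSets (colourings (toList X))
    within colouringsCost (3 ^ ∣ X ∣) n
colouringsʷ {n} X {y} = adjust (reverse-foldl extend ([] ∷ []) (toList X)) length-bits
  (⟨ reverseʷ encodeBool bits , constʷ (encodeCSets ([] ∷ [])) ⟩ʷ ⨾ʷ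
   consume-foldl encodeBool encodeCSets extend Inv extend-step (reverse bits) ([] ∷ []) start ⨾ʷ tlʷ)
  where
  bits : List Bool
  bits = toList X

  m : ℕ
  m = 3 ^ ∣ X ∣

  length-bits : length bits ≡ n
  length-bits = length-toList X

  adjust : ∀ {Ls Ls′ l} → Ls ≡ Ls′ → l ≡ n →
    colouringsᵖ ⊢ node (encodeSubset X) y ⇓ encodeCSets Ls
      within suc (suc (reverseCost l + 3) + suc (loopCost (length (reverse bits)) (extendCost m) + 1)) →
    colouringsᵖ ⊢ node (encodeSubset X) y ⇓ encodeCSets Ls′ within colouringsCost m n
  adjust refl refl r rewrite length-reverse bits | length-bits = r

  -- The lists present times the factor still to come never exceed the final number `m`. So `m`
  -- bounds every intermediate length, and with it the cost of every extension.
  Inv : List Bool → List (List CSet) → Set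
  Inv bs Ls = length Ls * #colourings bs ≤ m

  #colourings>0 : ∀ bs → 1 ≤ #colourings bs
  #colourings>0 []           = ≤-refl
  #colourings>0 (true ∷ bs)  = ≤-trans (#colourings>0 bs) (m≤m+n _ _)
  #colourings>0 (false ∷ bs) = ≤-trans (#colourings>0 bs) (m≤m+n _ _)

  extend-step : ∀ b bs Ls → Inv (b ∷ bs) Ls → Inv bs (extend Ls b) ×
    extendᵖ ⊢ node (encodeList encodeBool (b ∷ bs)) (encodeCSets Ls) ⇓ encodeCSets (extend Ls b) within extendCost m
  extend-step b bs Ls inv = (begin
      length (extend Ls b) * #colourings bs          ≡⟨ cong (_* #colourings bs) (trans (length-extend b [] Ls) (+-identityʳ _)) ⟩
      (length Ls * branching b) * #colourings bs     ≡⟨ *-assoc (length Ls) (branching b) (#colourings bs) ⟩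
      length Ls * #colourings (b ∷ bs)               ≤⟨ inv ⟩
      m                                              ∎)
    , weaken-within (s≤s (+-monoʳ-≤ 7 (s≤s (+-monoˡ-≤ 3 (loopCost-monoˡ growCost few))))) (extendʷ b Ls)
    where
    open ≤-Reasoning
    few : length Ls ≤ m
    few = begin
      length Ls                            ≡⟨ *-identityʳ _ ⟨
      length Ls * 1                        ≤⟨ *-monoʳ-≤ (length Ls) (#colourings>0 (b ∷ bs)) ⟩
      length Ls * #colourings (b ∷ bs)     ≤⟨ inv ⟩
      m                                    ∎

  start : Inv (reverse bits) ([] ∷ [])
  start = ≤-reflexive (trans (+-identityʳ _)
    (trans (product-↭ (map⁺ branching (↭-reverse bits))) (#colourings-toList X)))

tryᵖ : Program
tryᵖ = ⟨ if ⟨ hd ⨾ hd , tl ⨾ tl ⟩ ⨾ compile solveᵉ then trueᵖ else (tl ⨾ hd) , tl ⨾ tl ⟩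

tryCost : ℕ → ℕ
tryCost n = suc (suc (suc (7 + cost solveᵉ n) + 6) + 3)

module _ {n} (X : Subset n) (E : Rel n) where

  try : Bool → List CSet → Bool
  try b l = ifᵇ solve (decode l) (lookup X) E then true else b

  -- Behind the accumulator lies the environment of `solveᵉ` except for its first entry, the
  -- colouring, which each round puts in front.
  state : Bool → Tree
  state b = node (encodeBool b) (node (encodeSubset X) (node (encode rel E) (encodeℕ n)))

  tryʷ : ∀ b l {rest} → length l ≡ n →
    tryᵖ ⊢ node (node (encodeList encodeCSet l) rest) (state b) ⇓ state (try b l) within tryCost n
  tryʷ b l {rest} eq = ⟨ ifʷ encodeBool (solve (decode l) (lookup X) E) true b
      (⟨ hdʷ ⨾ʷ hdʷ , tlʷ ⨾ʷ tlʷ ⟩ʷ ⨾ʷ run) trueʷ (tlʷ ⨾ʷ hdʷ)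
    , tlʷ ⨾ʷ tlʷ ⟩ʷ
    where
    run : compile solveᵉ ⊢ node (encodeList encodeCSet l) (node (encodeSubset X) (node (encode rel E) (encodeℕ n)))
      ⇓ encodeBool (solve (decode l) (lookup X) E) within cost solveᵉ n
    run = subst₂ (λ x y → compile solveᵉ ⊢ node x (node y (node (encode rel E) (encodeℕ n)))
        ⇓ encodeBool (solve (decode l) (lookup X) E) within cost solveᵉ n)
      (encode-decode l eq) (encode-subset X)
      (compile-correct solveᵉ (decode l ∷ lookup X ∷ E ∷ []))

  T-try : ∀ Ls b → T (foldl try b Ls) ⇔ (T b ⊎ ∃ λ l → l ∈ Ls × T (solve (decode l) (lookup X) E))
  T-try [] b = mk⇔ inj₁ λ { (inj₁ p) → p ; (inj₂ (_ , () , _)) }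
  T-try (l ∷ Ls) b = mk⇔
    (λ p → [ [ (λ q → inj₂ (l , here refl , q)) , inj₁ ]′ ∘ to (T-∨ {solve (decode l) (lookup X) E})
           , (λ (k , k∈ , q) → inj₂ (k , there k∈ , q)) ]′ (to (T-try Ls (try b l)) p))
    λ { (inj₁ p) → from (T-try Ls (try b l)) (inj₁ (from (T-∨ {solve (decode l) (lookup X) E}) (inj₂ p)))
      ; (inj₂ (_ , here refl , q)) → from (T-try Ls (try b l)) (inj₁ (from (T-∨ {solve (decode l) (lookup X) E}) (inj₁ q)))
      ; (inj₂ (k , there k∈ , q)) → from (T-try Ls (try b l)) (inj₂ (k , k∈ , q)) }

  answer : Bool
  answer = foldl try false (colourings (toList X))

searchᵖ : Program
searchᵖ = ⟨ colouringsᵖ , ⟨ null , ⟨ hd , ⟨ tl , lengthᵖ ⟩ ⟩ ⟩ ⟩ ⨾ consume tryᵖ ⨾ tl ⨾ hd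

searchCost : ℕ → ℕ → ℕ
searchCost m n =
  suc (suc (colouringsCost m n + suc (1 + suc (1 + suc (1 + lengthCost n)))) +
       suc (loopCost m (tryCost n) + 3))

searchʷ : ∀ {n} (X : Subset n) (E : Rel n) →
  searchᵖ ⊢ node (encodeSubset X) (encode rel E) ⇓ encodeBool (answer X E) within searchCost (3 ^ ∣ X ∣) n
searchʷ {n} X E =
  ⟨ colouringsʷ X , ⟨ nullʷ , ⟨ hdʷ , ⟨ tlʷ , order ⟩ʷ ⟩ʷ ⟩ʷ ⟩ʷ ⨾ʷ
  loop ⨾ʷ tlʷ ⨾ʷ hdʷ
  where
  order : lengthᵖ ⊢ node (encodeSubset X) (encode rel E) ⇓ encodeℕ n within lengthCost n
  order = subst (λ m → lengthᵖ ⊢ node (encodeSubset X) (encode rel E) ⇓ encodeℕ m within lengthCost m)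
    (length-tabulate {n = n} id) (lengthʷ (λ i → encode vset (E i)) (allFin n))

  #colours : length (colourings (toList X)) ≡ 3 ^ ∣ X ∣
  #colours = trans (length-colourings (toList X)) (#colourings-toList X)

  loop : consume tryᵖ ⊢ node (encodeCSets (colourings (toList X))) (state X E false)
    ⇓ node nil (state X E (answer X E)) within loopCost (3 ^ ∣ X ∣) (tryCost n)
  loop = subst (λ m → consume tryᵖ ⊢ node (encodeCSets (colourings (toList X))) (state X E false)
      ⇓ node nil (state X E (answer X E)) within loopCost m (tryCost n)) #colours
    (consume-foldl (encodeList encodeCSet) (state X E) (try X E) (λ Ls _ → All (λ l → length l ≡ n) Ls)
      (λ { l Ls b (eq ∷ eqs) → eqs , tryʷ X E b l eq })
      (colourings (toList X)) false (All.tabulate (colourings-length X)))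

-- Costs are affine in the number of colourings.

record Scalable (h : ℕ → ℕ → ℕ) : Set where
  constructor scalable
  field scale : ∀ m n → h (suc m) n ≤ suc m * h 1 n

scalable-const : ∀ (g : ℕ → ℕ) → Scalable (λ _ n → g n)
scalable-const g = scalable λ m n → m≤m+n (g n) _

scalable-+ : ∀ {g h} → Scalable g → Scalable h → Scalable (λ m n → g m n + h m n)
scalable-+ {g} {h} (scalable G) (scalable H) = scalable λ m n → begin
  g (suc m) n + h (suc m) n         ≤⟨ +-mono-≤ (G m n) (H m n) ⟩
  suc m * g 1 n + suc m * h 1 n     ≡⟨ *-distribˡ-+ (suc m) (g 1 n) (h 1 n) ⟨
  suc m * (g 1 n + h 1 n)           ∎
  where open ≤-Reasoning

scalable-suc : ∀ {g} → Scalable g → Scalable (λ m n → suc (g m n))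
scalable-suc = scalable-+ (scalable-const (λ _ → 1))

scalable-*ˡ : ∀ {h} (g : ℕ → ℕ) → Scalable h → Scalable (λ m n → g n * h m n)
scalable-*ˡ {h} g (scalable H) = scalable λ m n → begin
  g n * h (suc m) n      ≤⟨ *-monoʳ-≤ (g n) (H m n) ⟩
  g n * (suc m * h 1 n)  ≡⟨ x∙yz≈y∙xz (g n) (suc m) (h 1 n) ⟩
  suc m * (g n * h 1 n)  ∎
  where
  open ≤-Reasoning
  open import Algebra.Properties.CommutativeSemigroup *-commutativeSemigroup using (x∙yz≈y∙xz)

scalable-multiple : ∀ (g : ℕ → ℕ) → Scalable (λ m n → m * g n)
scalable-multiple g = scalable λ m n → *-monoʳ-≤ (suc m) (m≤m+n (g n) 0)

scalable-loopˡ : ∀ (g : ℕ → ℕ) → Scalable (λ m n → loopCost m (g n))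
scalable-loopˡ g = scalable-+ (scalable-multiple (λ n → g n + 6)) (scalable-const (λ _ → 2))

scalable-loopʳ : ∀ {h} → Scalable h → Scalable (λ m n → loopCost n (h m n))
scalable-loopʳ H =
  scalable-+ (scalable-*ˡ id (scalable-+ H (scalable-const (λ _ → 6)))) (scalable-const (λ _ → 2))

scalable-searchCost : Scalable searchCost
scalable-searchCost =
  scalable-suc (scalable-+
    (scalable-suc (scalable-+
      (scalable-suc (scalable-+ (scalable-const (λ n → suc (reverseCost n + 3)))
        (scalable-suc (scalable-+
          (scalable-loopʳ (scalable-suc (scalable-+ (scalable-const (λ _ → 7))
            (scalable-suc (scalable-+ (scalable-loopˡ (λ _ → growCost)) (scalable-const (λ _ → 3)))))))
          (scalable-const (λ _ → 1))))))
      (scalable-const (λ n → suc (1 + suc (1 + suc (1 + lengthCost n)))))))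
    (scalable-suc (scalable-+ (scalable-loopˡ tryCost) (scalable-const (λ _ → 3)))))

polynomial-searchCost : Polynomial (searchCost 1)
polynomial-searchCost =
  polynomial-suc (polynomial-+
    (polynomial-suc (polynomial-+
      (polynomial-suc (polynomial-+
        (polynomial-suc (polynomial-+
          (polynomial-suc (polynomial-+ (polynomial-const 3)
            (polynomial-suc (polynomial-+ (polynomial-loopCost polynomial-id (polynomial-const 5)) (polynomial-const 1)))))
          (polynomial-const 3)))
        (polynomial-suc (polynomial-+
          (polynomial-loopCost polynomial-id (polynomial-const (extendCost 1))) (polynomial-const 1)))))
      (polynomial-suc (polynomial-suc (polynomial-suc (polynomial-suc (polynomial-suc (polynomial-suc
        (polynomial-suc (polynomial-+ (polynomial-const 3) (polynomial-suc (polynomial-+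
          (polynomial-loopCost polynomial-id (polynomial-const 3)) (polynomial-const 1)))))))))))))
    (polynomial-suc (polynomial-+
      (polynomial-loopCost (polynomial-const 1)
        (polynomial-suc (polynomial-+
          (polynomial-suc (polynomial-+
            (polynomial-suc (polynomial-+ (polynomial-const 7) (cost-polynomial solveᵉ)))
            (polynomial-const 6)))
          (polynomial-const 3))))
      (polynomial-const 3))))

-- Hitting sets and independent cutsets in terms of colourings

T⇒true : ∀ {b} → T b → b ≡ true
T⇒true {true} _ = refl

¬T⇒false : ∀ {b} → ¬ T b → b ≡ false
¬T⇒false {true}  p = ⊥-elim (p tt)
¬T⇒false {false} _ = refl

∈⇒T : ∀ {n} {S : Subset n} {u} → u Subset.∈ S → T (lookup S u)
∈⇒T u∈S = subst T (sym ([]=⇒lookup u∈S)) tt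

T⇒∈ : ∀ {n} {S : Subset n} {u} → T (lookup S u) → u Subset.∈ S
T⇒∈ {S = S} {u} p = lookup⇒[]= u S (T⇒true p)

-- Distinct vertices of the path have distinct neighbourhoods, so a map that matches adjacencies is
-- injective; this is why `NoInducedP₅` need not ask for distinct vertices.
path₅-twin-free : ∀ i j → (∀ k → adj (path 5) i k ≡ adj (path 5) j k) → i ≡ j
path₅-twin-free = from-yes (all? λ i → all? λ j →
  all? (λ k → adj (path 5) i k ≟ᵇ adj (path 5) j k) →-dec i ≟ j)

module _ {n} (G : Graph (Fin n)) where

  private
    E : Rel n
    E = adj G

  E-sym : ∀ {u w} → T (E u w) → T (E w u)
  E-sym {u} {w} = subst T (Graph.sym G u w)

  E-irrefl : ∀ {u} → ¬ T (E u u)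
  E-irrefl {u} = subst T (Graph.irrefl G u)

  hittingSet⇒noInducedP₅ : ∀ {X} → P₅-HittingSet G X → NoInducedP₅ E E-sym E-irrefl (∁ (lookup X))
  hittingSet⇒noInducedP₅ {X} free {a} {b} {c} {d} {e} a∉ b∉ c∉ d∉ e∉ ab bc cd de ac ad ae bd be ce =
    free (place , injective , matches)
    where
    outside : ∀ {u} → T (∁ (lookup X) u) → u Subset.∉ X
    outside u∈∁X u∈X = to T-∁ u∈∁X (∈⇒T u∈X)

    place : Fin 5 → Σ (Fin n) (Subset._∉ X)
    place 0F = a , outside a∉
    place 1F = b , outside b∉
    place 2F = c , outside c∉
    place 3F = d , outside d∉
    place 4F = e , outside e∉

    mirror : ∀ {u w x} → adj G u w ≡ x → adj G w u ≡ x
    mirror {u} {w} = trans (Graph.sym G w u)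

    matches : ∀ i j → adj (G - X) (place i) (place j) ≡ adj (path 5) i j
    matches 0F 0F = Graph.irrefl G a
    matches 0F 1F = T⇒true ab
    matches 0F 2F = ¬T⇒false ac
    matches 0F 3F = ¬T⇒false ad
    matches 0F 4F = ¬T⇒false ae
    matches 1F 1F = Graph.irrefl G b
    matches 1F 2F = T⇒true bc
    matches 1F 3F = ¬T⇒false bd
    matches 1F 4F = ¬T⇒false be
    matches 2F 2F = Graph.irrefl G c
    matches 2F 3F = T⇒true cd
    matches 2F 4F = ¬T⇒false ce
    matches 3F 3F = Graph.irrefl G d
    matches 3F 4F = T⇒true de
    matches 4F 4F = Graph.irrefl G e
    matches 1F 0F = mirror {a} {b} (T⇒true ab)
    matches 2F 0F = mirror {a} {c} (¬T⇒false ac)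
    matches 2F 1F = mirror {b} {c} (T⇒true bc)
    matches 3F 0F = mirror {a} {d} (¬T⇒false ad)
    matches 3F 1F = mirror {b} {d} (¬T⇒false bd)
    matches 3F 2F = mirror {c} {d} (T⇒true cd)
    matches 4F 0F = mirror {a} {e} (¬T⇒false ae)
    matches 4F 1F = mirror {b} {e} (¬T⇒false be)
    matches 4F 2F = mirror {c} {e} (¬T⇒false ce)
    matches 4F 3F = mirror {d} {e} (T⇒true de)

    injective : ∀ {i j} → place i ≡ place j → i ≡ j
    injective {i} {j} eq = path₅-twin-free i j λ k →
      trans (sym (matches i k)) (trans (cong (λ v → adj (G - X) v (place k)) eq) (matches j k))

  -- The cut class is the cutset: a walk avoiding it that starts on the left can never switch sides.
  colouring⇒cutset : ∀ {φ a b} → Proper E φ → φ a ≡ left → φ b ≡ right → ∃ λ S → IndependentCutset G S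
  colouring⇒cutset {φ} {a} {b} proper φa φb = S ,
    ((a , off (λ p → contradiction (trans (sym φa) p) λ ())) , (b , off (λ p → contradiction (trans (sym φb) p) λ ()))
      , λ walk → contradiction (trans (sym (stays-left walk φa)) φb) λ ())
    , λ u v u∈S v∈S e → two-cuts (φ u) (φ v) (proper u v e) (in-cut u∈S) (in-cut v∈S)
    where
    S : Subset n
    S = Vec.tabulate (λ u → φ u == cut)

    in-cut : ∀ {u} → u Subset.∈ S → φ u ≡ cut
    in-cut {u} u∈S = to T-== (subst T (lookup∘tabulate _ u) (∈⇒T u∈S))

    off : ∀ {u} → φ u ≢ cut → u Subset.∉ S
    off φu≢cut u∈S = φu≢cut (in-cut u∈S)

    two-cuts : ∀ c d → T (compatible c d) → c ≡ cut → d ≢ cut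
    two-cuts cut cut () refl refl

    next-left : ∀ c d → T (compatible c d) → c ≡ left → d ≢ cut → d ≡ left
    next-left left left _ refl _ = refl
    next-left left cut  _ refl p = ⊥-elim (p refl)

    stays-left : ∀ {u v} → Star (Adj (G - S)) u v → φ (proj₁ u) ≡ left → φ (proj₁ v) ≡ left
    stays-left ε p = p
    stays-left {u} (_◅_ {j = w} e walk) p = stays-left walk
      (next-left (φ (proj₁ u)) (φ (proj₁ w)) (proper (proj₁ u) (proj₁ w) e) p λ q →
        proj₂ w (T⇒∈ (subst T (sym (lookup∘tabulate _ (proj₁ w))) (from T-== q))))

  cutset⇒colouring : ∀ {S} → IndependentCutset G S →
    ∃ λ φ → Proper E φ × (∃ λ a → φ a ≡ left) × (∃ λ b → φ b ≡ right)
  cutset⇒colouring {S} (((a , a∉S) , (b , b∉S) , separated) , independent) =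
    φ , (λ u w e → proper u w e) , (a , φ-left a∉S a∈R) , (b , φ-right b∉S b∉R)
    where
    P R : VSet n
    P = ∁ (lookup S)
    R = reach E P a

    in-P : ∀ {u} → u Subset.∉ S → T (P u)
    in-P u∉S = from T-∁ (u∉S ∘ T⇒∈)

    a∈R : T (R a)
    a∈R = reach-root E P a (in-P a∉S)

    b∉R : ¬ T (R b)
    -- Vertices of `G - S` carry a proof of lying off `S`, so the predicate quantifies over these
    -- proofs; it holds vacuously at vertices of `S`, which `reach` may also contain.
    b∉R b∈R = reach-least E P a (in-P a∉S) (λ u → (u∉S : u Subset.∉ S) → Star (Adj (G - S)) (a , a∉S) (u , u∉S))
      (λ _ → ε) (λ {u} {w} w∈P walk e u∉S → walk (to T-∁ w∈P ∘ ∈⇒T) ◅◅ (E-sym e ◅ ε)) b∈R λ walk → separated (walk b∉S)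

    φ : Fin n → Color
    φ u = ifᵇ lookup S u then cut else (ifᵇ R u then left else right)

    data View (u : Fin n) : Color → Set where
      in-cut   : T (lookup S u) → View u cut
      in-left  : ¬ T (lookup S u) → T (R u) → View u left
      in-right : ¬ T (lookup S u) → ¬ T (R u) → View u right

    view : ∀ u → View u (φ u)
    view u with lookup S u in s | R u in r
    ... | true  | _     = in-cut (subst T (sym s) tt)
    ... | false | true  = in-left (subst T s) (subst T (sym r) tt)
    ... | false | false = in-right (subst T s) (subst T r)

    φ-left : ∀ {u} → u Subset.∉ S → T (R u) → φ u ≡ left
    φ-left {u} u∉S u∈R with φ u | view u
    ... | _ | in-cut p     = contradiction (T⇒∈ p) u∉S
    ... | _ | in-left _ _  = refl
    ... | _ | in-right _ p = contradiction u∈R p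

    φ-right : ∀ {u} → u Subset.∉ S → ¬ T (R u) → φ u ≡ right
    φ-right {u} u∉S u∉R with φ u | view u
    ... | _ | in-cut p     = contradiction (T⇒∈ p) u∉S
    ... | _ | in-left _ p  = contradiction p u∉R
    ... | _ | in-right _ _ = refl

    edge : ∀ {u w c d} → T (E u w) → View u c → View w d → T (compatible c d)
    edge e (in-cut p)     (in-cut q)     = independent _ _ (T⇒∈ p) (T⇒∈ q) e
    edge e (in-cut _)     (in-left _ _)  = tt
    edge e (in-cut _)     (in-right _ _) = tt
    edge e (in-left _ _)  (in-cut _)     = tt
    edge e (in-left _ _)  (in-left _ _)  = tt
    edge e (in-left p r)  (in-right q s) = s (reach-closed E P a (in-P a∉S) (from T-∁ p) r (E-sym e))
    edge e (in-right _ _) (in-cut _)     = tt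
    edge e (in-right p r) (in-left q s)  = r (reach-closed E P a (in-P a∉S) (from T-∁ q) s e)
    edge e (in-right _ _) (in-right _ _) = tt

    proper : Proper E φ
    proper u w e = edge e (view u) (view w)

  answer-correct : ∀ {X} → P₅-HittingSet G X → T (answer X E) ⇔ ∃ λ S → IndependentCutset G S
  answer-correct {X} hitting = mk⇔ sound complete
    where
    sound : T (answer X E) → ∃ λ S → IndependentCutset G S
    sound p with to (T-try X E (colourings (toList X)) false) p
    ... | inj₂ (l , l∈ , solved) with solve-sound E E-sym E-irrefl (decode l) (lookup X) fixed solved
      where
      fixed : ∀ {x} → T (lookup X x) → ∃ λ c → ∀ {d} → T (decode l x d) → d ≡ c
      fixed {x} x∈X with colourings-fixed X l∈ x x∈X
      ... | c , eq = c , λ {d} p → to T-== (subst (λ f → T (f d)) eq p)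
    ...   | φ , proper , (a , φa) , (b , φb) = colouring⇒cutset proper φa φb

    complete : (∃ λ S → IndependentCutset G S) → T (answer X E)
    complete (S , cutset) with cutset⇒colouring cutset
    ... | φ , proper , (a , φa) , (b , φb) with colourings-complete X φ
    ...   | l , l∈ , φ∈l = from (T-try X E (colourings (toList X)) false) (inj₂ (l , l∈ ,
            solve-complete E E-sym E-irrefl proper (decode l) (lookup X) (hittingSet⇒noInducedP₅ hitting) φ∈l φa φb))

-- The total running time

order<size : ∀ {n} (G : Graph (Fin n)) → ∃ λ m → size (encodeGraph G) ≡ suc m × n ≤ m
order<size {n} G = go (allFin n) (length-tabulate id)
  where
  go : ∀ is {k} → length is ≡ k → ∃ λ m →
    size (encodeList (λ u → encodeList (λ v → encodeBool (adj G u v)) (allFin n)) is) ≡ suc m × k ≤ m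
  go []       refl = 0 , refl , z≤n
  go (i ∷ is) refl with go is refl
  ... | m , eq , k≤m rewrite eq = _ , refl , ≤-trans (s≤s k≤m) (m≤n+m (suc m) _)

-- The time of `p` is charged to `f k` and the search to `3 ^ k`, after which both factors are
-- enlarged to their sum. The summand 3 pays for the sequencing, the pair and `hd` that surround
-- `p`.
search-time : ∀ {n} (G : Graph (Fin n)) (X : Subset n) {f : ℕ → ℕ} {c d c′ d′ k t} →
  (∀ n → 3 + searchCost 1 n ≤ c′ * suc n ^ d′) → ∣ X ∣ ≤ k → t ≤ OStar f c d G k →
  suc (suc (t + 1) + searchCost (3 ^ ∣ X ∣) n) ≤ OStar (λ k → f k + 3 ^ k) (c + c′) (d + d′) G k
search-time {n} G X {f} {c} {d} {c′} {d′} {k} {t} search≤ X≤k t≤ = begin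
  suc (suc (t + 1) + searchCost (3 ^ ∣ X ∣) n)
    ≡⟨ regroup t (searchCost (3 ^ ∣ X ∣) n) ⟩
  t + (3 + searchCost (3 ^ ∣ X ∣) n)
    ≤⟨ +-mono-≤ t≤ search-bound ⟩
  f k * (c * s ^ d) + 3 ^ k * (c′ * s ^ d′)
    ≤⟨ +-mono-≤ (*-monoˡ-≤ _ (m≤m+n (f k) (3 ^ k))) (*-monoˡ-≤ _ (m≤n+m (3 ^ k) (f k))) ⟩
  (f k + 3 ^ k) * (c * s ^ d) + (f k + 3 ^ k) * (c′ * s ^ d′)
    ≡⟨ *-distribˡ-+ (f k + 3 ^ k) _ _ ⟨
  (f k + 3 ^ k) * (c * s ^ d + c′ * s ^ d′)
    ≤⟨ *-monoʳ-≤ (f k + 3 ^ k) combine ⟩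
  (f k + 3 ^ k) * ((c + c′) * s ^ (d + d′)) ∎
  where
  open ≤-Reasoning

  s : ℕ
  s = size (encodeGraph G)

  regroup : ∀ t u → suc (suc (t + 1) + u) ≡ t + (3 + u)
  regroup t u = trans (cong (λ v → suc (suc v) + u) (+-comm t 1))
    (sym (trans (+-suc t (2 + u)) (cong suc (trans (+-suc t (suc u)) (cong suc (+-suc t u))))))

  combine : c * s ^ d + c′ * s ^ d′ ≤ (c + c′) * s ^ (d + d′)
  combine = let m , eq , _ = order<size G in
    subst (λ s → c * s ^ d + c′ * s ^ d′ ≤ (c + c′) * s ^ (d + d′)) (sym eq) (monomial-+ m c c′ d d′)

  scaled : ∀ m → 1 ≤ m → 3 + searchCost m n ≤ m * (3 + searchCost 1 n)
  scaled (suc m) _ = Scalable.scale (scalable-+ (scalable-const (λ _ → 3)) scalable-searchCost) m n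

  n<s : suc n ≤ s
  n<s = let m , eq , n≤m = order<size G in subst (suc n ≤_) (sym eq) (s≤s n≤m)

  search-bound : 3 + searchCost (3 ^ ∣ X ∣) n ≤ 3 ^ k * (c′ * s ^ d′)
  search-bound = begin
    3 + searchCost (3 ^ ∣ X ∣) n          ≤⟨ scaled (3 ^ ∣ X ∣) (m^n>0 3 ∣ X ∣) ⟩
    3 ^ ∣ X ∣ * (3 + searchCost 1 n)      ≤⟨ *-mono-≤ (^-monoʳ-≤ 3 X≤k) (search≤ n) ⟩
    3 ^ k * (c′ * suc n ^ d′)             ≤⟨ *-monoʳ-≤ (3 ^ k) (*-monoʳ-≤ c′ (^-monoˡ-≤ d′ n<s)) ⟩
    3 ^ k * (c′ * s ^ d′)                 ∎

theorem4p14 : ∀ (f : ℕ → ℕ) →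
    P₅-HittingSet-ComputableInTimeOStar f →
    IndependentCutset-SolvableInTimeOStar (λ k → f k + 3 ^ k)
theorem4p14 f (p , c , d , hit) =
  -- The encoding of `G` is by definition `encode rel (adj G)`, so `hd` of the instance can be
  -- handed to the search as it is.
  ⟨ p , hd ⟩ ⨾ searchᵖ , c + c′ , d + d′ , λ G k admissible → solution G k (hit G k admissible)
  where
  polynomial : Polynomial (λ n → 3 + searchCost 1 n)
  polynomial = polynomial-+ (polynomial-const 3) polynomial-searchCost

  c′ d′ : ℕ
  c′ = proj₁ polynomial
  d′ = proj₁ (proj₂ polynomial)

  solution : ∀ {n} (G : Graph (Fin n)) (k : ℕ) →
    (∃₂ λ (X : Subset n) t → p ⊢ encodeInstance G k ⇓ encodeSubset X in-time t ×
      P₅-HittingSet G X × ∣ X ∣ ≤ k × t ≤ OStar f c d G k) →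
    ∃₂ λ b t → ⟨ p , hd ⟩ ⨾ searchᵖ ⊢ encodeInstance G k ⇓ encodeBool b in-time t ×
      (T b ⇔ ∃ λ S → IndependentCutset G S) × t ≤ OStar (λ k → f k + 3 ^ k) (c + c′) (d + d′) G k
  solution G k (X , t , p-run , hitting , X≤k , t≤) =
    answer X (adj G) , proj₁ total , proj₁ (proj₂ total) , answer-correct G hitting ,
    ≤-trans (proj₂ (proj₂ total)) (search-time G X {f} {c} {d} {c′} {d′} (proj₂ (proj₂ polynomial)) X≤k t≤)
    where
    total : ⟨ p , hd ⟩ ⨾ searchᵖ ⊢ encodeInstance G k ⇓ encodeBool (answer X (adj G))
      within suc (suc (t + 1) + searchCost (3 ^ ∣ X ∣) _)
    total = ⟨ (t , p-run , ≤-refl) , hdʷ ⟩ʷ ⨾ʷ searchʷ X (adj G)
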